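{- (ZF, without the Axiom of Choice.) (1) $UD(\omega_1)$ implies that $M(\omega_1,\omega,n)\to ED$ holds for each natural number $n\in\omega$. (2) $M(\omega_1,\omega,2)\to ED$ implies $cf(\omega_1)=\omega_1$.
   Context: The base theory is ZF. A function $f$ is a uniform denumeration on $\omega_1$ iff $\mathrm{dom}(f)=\omega_1$ and $f(\alpha)$ is a function from $\omega$ onto $\alpha$ for each $1\le\alpha<\omega_1$. $UD(\omega_1)$ is the assertion that there exists a uniform denumeration on $\omega_1$. A family $\mathcal A$ of sets is $n$-almost disjoint iff $|A\cap B|<n$ for each $\{A,B\}\in[\mathcal A]^2$. A family $\mathcal A$ is essentially disjoint iff there is a function $f$ with $\mathrm{dom}(f)=\mathcal A$ and $f(A)\in[A]^{<\omega}$ for each $A\in\mathcal A$ such that $\{A\setminus f(A):A\in\mathcal A\}$ is a family of pairwise disjoint sets. $M(\kappa,\omega,n)\to ED$ is the statement that every $n$-almost disjoint family $\mathcal A\subset[\kappa]^{\omega}$ is essentially disjoint, where $[\kappa]^\omega$ is the set of countably infinite subsets of $\kappa$. -}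

module Defs where

open import Data.Fin.Base using (Fin)
open import Data.Fin.Patterns using (0F; 1F)
open import Data.Nat.Base using (ℕ; suc)
open import Data.Product.Base using (∃; ∃-syntax; _×_; proj₁)
open import Data.Product using (∃!)
open import Data.Sum.Base using (_⊎_)
open import Data.Vec.Base using (Vec; []; _∷_; lookup)
open import Function.Bundles using (_⇔_)
open import Level using (Level) renaming (suc to lsuc)
open import Relation.Binary.PropositionalEquality.Core using (_≡_; _≢_)
open import Relation.Nullary.Negation.Core using (¬_)

-- First-order formulas of the language {∈, =} with n free variables
-- (de Bruijn indices).
data Formula (n : ℕ) : Set where
  _∈̇_ _≐_         : Fin n → Fin n → Formula n
  ¬̇_              : Formula n → Formula n
  _∧̇_ _∨̇_ _⇒̇_ : Formula n → Formula n → Formula n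
  ∀̇_ ∃̇_          : Formula (suc n) → Formula n

module Satisfaction {ℓ : Level} {V : Set ℓ} (_∈_ : V → V → Set ℓ) where

  _⊨_ : ∀ {n} → Vec V n → Formula n → Set ℓ
  ρ ⊨ (i ∈̇ j) = lookup ρ i ∈ lookup ρ j
  ρ ⊨ (i ≐ j)  = lookup ρ i ≡ lookup ρ j
  ρ ⊨ (¬̇ φ)   = ¬ (ρ ⊨ φ)
  ρ ⊨ (φ ∧̇ ψ) = (ρ ⊨ φ) × (ρ ⊨ ψ)
  ρ ⊨ (φ ∨̇ ψ) = (ρ ⊨ φ) ⊎ (ρ ⊨ ψ)
  ρ ⊨ (φ ⇒̇ ψ) = (ρ ⊨ φ) → (ρ ⊨ ψ)
  ρ ⊨ (∀̇ φ)   = ∀ x → (x ∷ ρ) ⊨ φ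
  ρ ⊨ (∃̇ φ)   = ∃[ x ] ((x ∷ ρ) ⊨ φ)

-- Models of ZF; excluded middle, as a hypothesis on the metatheory, makes their
-- logic classical.  Separation and replacement range over first-order formulas
-- with parameters, not over arbitrary predicates V → Set ℓ: as ∃ is a Σ-type,
-- replacement for arbitrary Agda relations would, with excluded middle, make
-- every model satisfy the axiom of choice.
record ZFModel (ℓ : Level) : Set (lsuc ℓ) where
  infix 4 _∈_ _⊆_
  infixl 6 _∪_ _∩_ _∖_
  infix 8 _⁺

  field
    V   : Set ℓ
    _∈_ : V → V → Set ℓ

  open Satisfaction _∈_ public

  _⊆_ : V → V → Set ℓ
  x ⊆ y = ∀ z → z ∈ x → z ∈ y

  field
    extensionality : ∀ x y → (∀ z → z ∈ x ⇔ z ∈ y) → x ≡ y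
    foundation     : ∀ x → (∃[ y ] y ∈ x) →
                     ∃[ y ] (y ∈ x × (∀ z → z ∈ y → ¬ (z ∈ x)))
    empty          : ∃[ e ] (∀ z → ¬ (z ∈ e))
    pairing        : ∀ x y → ∃[ p ] (∀ z → z ∈ p ⇔ (z ≡ x ⊎ z ≡ y))
    union          : ∀ x → ∃[ u ] (∀ z → z ∈ u ⇔ (∃[ y ] (y ∈ x × z ∈ y)))
    power          : ∀ x → ∃[ p ] (∀ z → z ∈ p ⇔ z ⊆ x)
    separation     : ∀ {n} (φ : Formula (suc n)) (ρ : Vec V n) a →
                     ∃[ b ] (∀ x → x ∈ b ⇔ (x ∈ a × (x ∷ ρ) ⊨ φ))
    replacement    : ∀ {n} (φ : Formula (suc (suc n))) (ρ : Vec V n) a →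
                     (∀ x y y′ → x ∈ a → (x ∷ y ∷ ρ) ⊨ φ →
                        (x ∷ y′ ∷ ρ) ⊨ φ → y ≡ y′) →
                     ∃[ b ] (∀ y → y ∈ b ⇔
                               (∃[ x ] (x ∈ a × (x ∷ y ∷ ρ) ⊨ φ)))

  ∅ : V
  ∅ = proj₁ empty

  ｛_,_｝ : V → V → V
  ｛ x , y ｝ = proj₁ (pairing x y)

  _∪_ : V → V → V
  x ∪ y = proj₁ (union ｛ x , y ｝)

  _∩_ : V → V → V
  x ∩ y = proj₁ (separation (0F ∈̇ 1F) (y ∷ []) x)

  _∖_ : V → V → V
  x ∖ y = proj₁ (separation (¬̇ (0F ∈̇ 1F)) (y ∷ []) x)

  _⁺ : V → V
  x ⁺ = x ∪ ｛ x , x ｝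

  Inductive : V → Set ℓ
  Inductive w = ∅ ∈ w × (∀ x → x ∈ w → x ⁺ ∈ w)

  field
    infinity : ∃[ w ] Inductive w

module SetTheory {ℓ : Level} (𝓜 : ZFModel ℓ) where
  open ZFModel 𝓜 public

  𝟏 𝟐 : V
  𝟏 = ∅ ⁺
  𝟐 = 𝟏 ⁺

  ⟨_,_⟩ : V → V → V
  ⟨ x , y ⟩ = ｛ ｛ x , x ｝ , ｛ x , y ｝ ｝

  -- f is a function with domain A.
  FunctionOn : V → V → Set ℓ
  FunctionOn f A =
    (∀ p → p ∈ f → ∃[ x ] ∃[ y ] (x ∈ A × p ≡ ⟨ x , y ⟩)) ×
    (∀ x → x ∈ A → ∃! _≡_ (λ y → ⟨ x , y ⟩ ∈ f))

  _∶_⟶_ : V → V → V → Set ℓ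
  f ∶ A ⟶ B = FunctionOn f A × (∀ x y → ⟨ x , y ⟩ ∈ f → y ∈ B)

  _∶_↠_ : V → V → V → Set ℓ
  f ∶ A ↠ B = (f ∶ A ⟶ B) × (∀ y → y ∈ B → ∃[ x ] ⟨ x , y ⟩ ∈ f)

  _∶_↣_ : V → V → V → Set ℓ
  f ∶ A ↣ B =
    (f ∶ A ⟶ B) × (∀ x x′ y → ⟨ x , y ⟩ ∈ f → ⟨ x′ , y ⟩ ∈ f → x ≡ x′)

  _≈_ : V → V → Set ℓ
  A ≈ B = ∃[ f ] ((f ∶ A ↣ B) × (f ∶ A ↠ B))

  Transitive : V → Set ℓ
  Transitive x = ∀ y → y ∈ x → y ⊆ x

  -- x is strictly well-ordered by ∈.
  WellOrdered : V → Set ℓ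
  WellOrdered x =
    (∀ a → a ∈ x → ¬ (a ∈ a)) ×
    (∀ a b c → a ∈ x → b ∈ x → c ∈ x → a ∈ b → b ∈ c → a ∈ c) ×
    (∀ a b → a ∈ x → b ∈ x → a ∈ b ⊎ a ≡ b ⊎ b ∈ a) ×
    (∀ s → s ⊆ x → (∃[ a ] a ∈ s) →
       ∃[ m ] (m ∈ s × (∀ a → a ∈ s → m ≡ a ⊎ m ∈ a)))

  Ordinal : V → Set ℓ
  Ordinal x = Transitive x × WellOrdered x

  -- The order on ordinals.
  _≤_ : V → V → Set ℓ
  α ≤ β = α ∈ β ⊎ α ≡ β

  IsOmega : V → Set ℓ
  IsOmega ω = Inductive ω × (∀ w → Inductive w → ω ⊆ w)

  Countable : (ω : V) → V → Set ℓ
  Countable ω x = ∃[ f ] (f ∶ x ↣ ω)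

  -- ω₁ is the least uncountable ordinal.
  IsOmega₁ : (ω ω₁ : V) → Set ℓ
  IsOmega₁ ω ω₁ =
    Ordinal ω₁ × ¬ Countable ω ω₁ × (∀ α → α ∈ ω₁ → Countable ω α)

  Cofinal : (f β α : V) → Set ℓ
  Cofinal f β α =
    (f ∶ β ⟶ α) ×
    (∀ ξ → ξ ∈ α → ∃[ η ] ∃[ ζ ] (⟨ η , ζ ⟩ ∈ f × ξ ≤ ζ))

  -- cf(α) = β: β is the least ordinal with a cofinal map into α.
  IsCofinality : (α β : V) → Set ℓ
  IsCofinality α β =
    Ordinal β × (∃[ f ] Cofinal f β α) ×
    (∀ γ → γ ∈ β → ¬ (∃[ f ] Cofinal f γ α))

  UniformDenumeration : (ω ω₁ f : V) → Set ℓ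
  UniformDenumeration ω ω₁ f =
    FunctionOn f ω₁ ×
    (∀ α g → 𝟏 ≤ α → α ∈ ω₁ → ⟨ α , g ⟩ ∈ f → g ∶ ω ↠ α)

  UD : (ω ω₁ : V) → Set ℓ
  UD ω ω₁ = ∃[ f ] UniformDenumeration ω ω₁ f

  -- |x| < n, for a natural number n (the elements of n are the naturals below n).
  Card< : V → V → Set ℓ
  Card< x n = ∃[ m ] (m ∈ n × x ≈ m)

  Finite : (ω : V) → V → Set ℓ
  Finite ω x = ∃[ m ] (m ∈ ω × x ≈ m)

  AlmostDisjoint : (n 𝒜 : V) → Set ℓ
  AlmostDisjoint n 𝒜 = ∀ A B → A ∈ 𝒜 → B ∈ 𝒜 → A ≢ B → Card< (A ∩ B) n

  -- The disjointness is that of the family indexed by A ∈ 𝒜: distinct members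
  -- A, B give disjoint A ∖ f(A), B ∖ f(B).
  EssentiallyDisjoint : (ω 𝒜 : V) → Set ℓ
  EssentiallyDisjoint ω 𝒜 =
    ∃[ f ] (FunctionOn f 𝒜 ×
            (∀ A F → ⟨ A , F ⟩ ∈ f → F ⊆ A × Finite ω F) ×
            (∀ A B F G → ⟨ A , F ⟩ ∈ f → ⟨ B , G ⟩ ∈ f → A ≢ B →
               (A ∖ F) ∩ (B ∖ G) ≡ ∅))

  -- The statement M(κ, ω, n) → ED.
  M→ED : (κ ω n : V) → Set ℓ
  M→ED κ ω n =
    ∀ 𝒜 → (∀ A → A ∈ 𝒜 → A ⊆ κ × A ≈ ω) →
    AlmostDisjoint n 𝒜 → EssentiallyDisjoint ω 𝒜

{-# OPTIONS --safe #-}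
module Submission where

open import Axiom.ExcludedMiddle using (ExcludedMiddle)
open import Data.Empty using (⊥; ⊥-elim)
open import Data.Fin.Base using (Fin; zero; suc; _↑ˡ_; _↑ʳ_)
open import Data.Fin.Patterns using (0F; 1F; 2F; 3F; 4F; 5F)
open import Data.Nat.Base using (ℕ; suc) renaming (_+_ to _+ℕ_)
open import Data.Product.Base using (∃; ∃-syntax; _×_; _,_; proj₁; proj₂)
open import Data.Product.Function.NonDependent.Propositional using (_×-⇔_)
open import Data.Sum.Base using (_⊎_; inj₁; inj₂; [_,_]′)
open import Data.Sum.Function.Propositional using (_⊎-⇔_)
open import Data.Vec.Base using (Vec; []; _∷_; lookup; tabulate; head; tail; _++_)
open import Data.Vec.Properties using
  (lookup-++ˡ; lookup-++ʳ; lookup∘tabulate; tabulate-cong; tabulate∘lookup)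
open import Function.Base using (_∘_; id; case_of_)
open import Function.Bundles using (_⇔_; mk⇔; Equivalence)
open import Function.Properties.Equivalence using ()
  renaming (refl to ⇔-refl; sym to ⇔-sym; trans to ⇔-trans)
open import Level using (Level)
open import Relation.Binary.PropositionalEquality.Core using (_≡_; _≢_; refl; sym; trans; cong; subst)
open import Relation.Nullary.Decidable.Core using (yes; no)
open import Relation.Nullary.Negation.Core using (¬_)
open import Defs

-- (1) Fix n and a family 𝒜.  Call a set big if it has more than n elements; a
-- big set lies in at most one member of 𝒜.  Call d < ω₁ closed if A ⊆ d
-- whenever A ∩ d is big.  UD makes ω₁ regular and makes {A : A ∩ α is big}
-- countable for α < ω₁, so the closed ordinals are unbounded.  Let d(A) be the
-- least closed d with A ∩ d big, and delete from A its intersections with the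
-- smaller closed ordinals (their union is not big) and with the B ≠ A such that
-- d(B) = d(A) and B shows n + 1 elements no later than A in the enumeration of
-- d(A) (there are finitely many such B, and each meets A in at most n points).
--
-- (2) Let g : γ → ω₁ be cofinal with γ < ω₁.  Write ω₁ as the union of the
-- columns {l + k : k ∈ ω}, l limit or 0, and of the countable rows consisting of
-- the l + k with k fixed and η ∈ γ least such that l + k ≤ g(η).  Columns and
-- infinite rows form a 2-almost disjoint family.  If it is essentially disjoint
-- then every column meets one of the countably many finite sets deleted from
-- the rows, so ω₁ is a union of finite sets indexed by ω³, and being linearly
-- ordered it is countable.

-- Without choice even a countable union of finite sets may fail to be countable, so countability is
-- never obtained by gluing enumerations. One fact serves both parts: `ω₁` is not a union of finite
-- sets indexed by `ω`, since such pieces allow a reordering of `ω₁` with finite initial segments,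
-- which embeds in `ω`. In (1) the denumeration turns this fact into regularity; in (2) it is the
-- final contradiction. Members of the family carry no order, so in (1) they are only sorted into
-- finite classes, one for each natural number, and ordinals stand in for them when a bound is
-- wanted. Bigness is witnessed by finitely many points, so along a chain of ordinals it shows up at
-- a single member; this makes suprema of iterates closed and keeps the part below the level small.
-- Separation is restricted to formulas, so every witness that enters a set must be canonical,
-- mostly a least ordinal, and every induction predicate must be a formula.

module ZermeloFraenkel {ℓ : Level} (em : ExcludedMiddle ℓ) (𝓜 : ZFModel ℓ) where

  open SetTheory 𝓜
  open Equivalence using (to; from)

  -- Extensionality and the basic set operations.

  ext : ∀ {x y} → x ⊆ y → y ⊆ x → x ≡ y
  ext {x} {y} p q = extensionality x y λ z → mk⇔ (p z) (q z)

  ∈｛,｝ : ∀ {z x y} → z ∈ ｛ x , y ｝ ⇔ (z ≡ x ⊎ z ≡ y)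
  ∈｛,｝ {z} {x} {y} = proj₂ (pairing x y) z

  ∈∪ : ∀ {z x y} → z ∈ x ∪ y ⇔ (z ∈ x ⊎ z ∈ y)
  ∈∪ {z} {x} {y} = mk⇔
    (λ h → case to (proj₂ (union ｛ x , y ｝) z) h of λ where
      (w , w∈ , z∈w) → case to ∈｛,｝ w∈ of λ where
        (inj₁ refl) → inj₁ z∈w
        (inj₂ refl) → inj₂ z∈w)
    (λ where
      (inj₁ h) → from (proj₂ (union ｛ x , y ｝) z) (x , from ∈｛,｝ (inj₁ refl) , h)
      (inj₂ h) → from (proj₂ (union ｛ x , y ｝) z) (y , from ∈｛,｝ (inj₂ refl) , h))

  ∈∩ : ∀ {z x y} → z ∈ x ∩ y ⇔ (z ∈ x × z ∈ y)
  ∈∩ {z} {x} {y} = proj₂ (separation (0F ∈̇ 1F) (y ∷ []) x) z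

  ∈∖ : ∀ {z x y} → z ∈ x ∖ y ⇔ (z ∈ x × ¬ z ∈ y)
  ∈∖ {z} {x} {y} = proj₂ (separation (¬̇ (0F ∈̇ 1F)) (y ∷ []) x) z

  -- Definability and a formula language for separation.

  -- Predicates definable by a first-order formula with parameters.  The formula
  -- is given for every placement of its variables and parameters in an
  -- environment, which makes renaming and merging of parameters trivial.

  record Definable {n} (P : Vec V n → Set ℓ) : Set ℓ where
    field
      arity   : ℕ
      params  : Vec V arity
      formula : ∀ {m} → (Fin n → Fin m) → (Fin arity → Fin m) → Formula m
      correct : ∀ {m} (ρ : Vec V m) v p → (∀ j → lookup ρ (p j) ≡ lookup params j) →
                (ρ ⊨ formula v p) ⇔ P (tabulate (lookup ρ ∘ v))

  open Definable

  extend : ∀ {n m} → (Fin n → Fin m) → Fin (suc n) → Fin (suc m)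
  extend v zero    = zero
  extend v (suc i) = suc (v i)

  definable-resp : ∀ {n} {P Q : Vec V n → Set ℓ} → (∀ ρ → P ρ ⇔ Q ρ) →
                   Definable P → Definable Q
  definable-resp P⇔Q d = record
    { arity = arity d ; params = params d ; formula = formula d
    ; correct = λ ρ v p h → ⇔-trans (correct d ρ v p h) (P⇔Q _) }

  definable-combine : ∀ {n} {P Q : Vec V n → Set ℓ}
    (_⊙_ : ∀ {m} → Formula m → Formula m → Formula m) (_⊛_ : Set ℓ → Set ℓ → Set ℓ) →
    (∀ {m} {ρ : Vec V m} {φ ψ A B} → (ρ ⊨ φ) ⇔ A → (ρ ⊨ ψ) ⇔ B → (ρ ⊨ (φ ⊙ ψ)) ⇔ (A ⊛ B)) →
    Definable P → Definable Q → Definable (λ ρ → P ρ ⊛ Q ρ)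
  definable-combine _⊙_ _⊛_ sem d e = record
    { arity   = arity d +ℕ arity e
    ; params  = params d ++ params e
    ; formula = λ v p → formula d v (p ∘ (_↑ˡ arity e)) ⊙ formula e v (p ∘ (arity d ↑ʳ_))
    ; correct = λ ρ v p h → sem
        (correct d ρ v _ λ j → trans (h _) (lookup-++ˡ (params d) (params e) j))
        (correct e ρ v _ λ j → trans (h _) (lookup-++ʳ (params d) (params e) j)) }

  →-⇔ : ∀ {A B C D : Set ℓ} → A ⇔ B → C ⇔ D → (A → C) ⇔ (B → D)
  →-⇔ a c = mk⇔ (λ f → to c ∘ f ∘ from a) (λ f → from c ∘ f ∘ to a)

  definable-∧ : ∀ {n} {P Q : Vec V n → Set ℓ} → Definable P → Definable Q → Definable (λ ρ → P ρ × Q ρ)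
  definable-∧ = definable-combine _∧̇_ _×_ _×-⇔_

  definable-∨ : ∀ {n} {P Q : Vec V n → Set ℓ} → Definable P → Definable Q → Definable (λ ρ → P ρ ⊎ Q ρ)
  definable-∨ = definable-combine _∨̇_ _⊎_ _⊎-⇔_

  definable-⇒ : ∀ {n} {P Q : Vec V n → Set ℓ} → Definable P → Definable Q → Definable (λ ρ → P ρ → Q ρ)
  definable-⇒ = definable-combine _⇒̇_ (λ A B → A → B) →-⇔

  definable-¬ : ∀ {n} {P : Vec V n → Set ℓ} → Definable P → Definable (λ ρ → ¬ P ρ)
  definable-¬ d = record
    { arity = arity d ; params = params d ; formula = λ v p → ¬̇ formula d v p
    ; correct = λ ρ v p h → let c = correct d ρ v p h in mk⇔ (_∘ from c) (_∘ to c) }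

  definable-∀ : ∀ {n} {P : Vec V (suc n) → Set ℓ} → Definable P → Definable (λ ρ → ∀ x → P (x ∷ ρ))
  definable-∀ d = record
    { arity = arity d ; params = params d ; formula = λ v p → ∀̇ formula d (extend v) (suc ∘ p)
    ; correct = λ ρ v p h → let c = λ x → correct d (x ∷ ρ) (extend v) (suc ∘ p) h in
        mk⇔ (λ f x → to (c x) (f x)) (λ f x → from (c x) (f x)) }

  definable-∃ : ∀ {n} {P : Vec V (suc n) → Set ℓ} → Definable P → Definable (λ ρ → ∃[ x ] P (x ∷ ρ))
  definable-∃ d = record
    { arity = arity d ; params = params d ; formula = λ v p → ∃̇ formula d (extend v) (suc ∘ p)
    ; correct = λ ρ v p h → let c = λ x → correct d (x ∷ ρ) (extend v) (suc ∘ p) h in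
        mk⇔ (λ (x , q) → x , to (c x) q) (λ (x , q) → x , from (c x) q) }

  definable-rename : ∀ {n m} {P : Vec V n → Set ℓ} (σ : Fin n → Fin m) →
                     Definable P → Definable (λ ρ → P (tabulate (lookup ρ ∘ σ)))
  definable-rename {P = P} σ d = record
    { arity = arity d ; params = params d ; formula = λ v p → formula d (v ∘ σ) p
    ; correct = λ ρ v p h → subst (λ τ → _ ⇔ P τ)
        (sym (tabulate-cong λ i → lookup∘tabulate (lookup ρ ∘ v) (σ i)))
        (correct d ρ (v ∘ σ) p h) }

  definable-∈ : ∀ {n} (i j : Fin n) → Definable (λ ρ → lookup ρ i ∈ lookup ρ j)
  definable-∈ i j = record
    { arity = 0 ; params = [] ; formula = λ v p → v i ∈̇ v j
    ; correct = λ ρ v p h → subst (λ x → _ ⇔ (x ∈ _)) (sym (lookup∘tabulate (lookup ρ ∘ v) i))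
        (subst (λ x → _ ⇔ (_ ∈ x)) (sym (lookup∘tabulate (lookup ρ ∘ v) j)) ⇔-refl) }

  definable-∈-constant : ∀ {n} (i : Fin n) c → Definable (λ ρ → lookup ρ i ∈ c)
  definable-∈-constant i c = record
    { arity = 1 ; params = c ∷ [] ; formula = λ v p → v i ∈̇ p 0F
    ; correct = λ ρ v p h → subst (λ x → _ ⇔ (x ∈ c)) (sym (lookup∘tabulate (lookup ρ ∘ v) i))
        (subst (λ x → _ ⇔ (_ ∈ x)) (h 0F) ⇔-refl) }

  DefinableTerm : ∀ {n} → (Vec V n → V) → Set ℓ
  DefinableTerm T = Definable (λ ρ → head ρ ∈ T (tail ρ))

  -- Extensionality reduces the equation to two inclusions, so a formula for membership in `T` is
  -- enough to express equality with `T`.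
  definable-≡ : ∀ {n} {T : Vec V n → V} → DefinableTerm T → Definable (λ ρ → head ρ ≡ T (tail ρ))
  definable-≡ {n} {T} d = definable-resp
    (λ { (z ∷ ρ) → mk⇔
      (λ (p , q) → ext (λ w h → subst (λ τ → w ∈ T τ) (tabulate∘lookup ρ) (p w h))
                       (λ w h → q w (subst (λ τ → w ∈ T τ) (sym (tabulate∘lookup ρ)) h)))
      (λ { refl → (λ w h → subst (λ τ → w ∈ T τ) (sym (tabulate∘lookup ρ)) h)
                , (λ w h → subst (λ τ → w ∈ T τ) (tabulate∘lookup ρ) h) }) })
    (definable-∧ (definable-∀ (definable-⇒ w∈z w∈T)) (definable-∀ (definable-⇒ w∈T w∈z)))
    where
      w∈z = definable-∈ {suc (suc n)} 0F 1F
      w∈T = definable-rename (extend {m = suc n} suc) d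

  -- An existential quantifier names the value `T ρ`; this is how terms are eliminated from
  -- formulas.
  definable-let : ∀ {n} {T : Vec V n → V} {P : Vec V (suc n) → Set ℓ} →
                  DefinableTerm T → Definable P → Definable (λ ρ → P (T ρ ∷ ρ))
  definable-let d e = definable-resp
    (λ ρ → mk⇔ (λ { (_ , refl , p) → p }) (λ p → _ , refl , p))
    (definable-∃ (definable-∧ (definable-≡ d) e))

  infixl 9 _∪ᵗ_ _∩ᵗ_ _∖ᵗ_
  infix  8 _∈ᶠ_ _≡ᶠ_
  infix  7 ¬ᶠ_
  infixr 6 _∧ᶠ_
  infixr 5 _∨ᶠ_
  infixr 4 _⇒ᶠ_
  infix  7 ∀ᶠ_ ∃ᶠ_
  infix  9 _[_]

  -- Formulas with set constants, some set operations, renaming and local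
  -- definitions: their interpretation unfolds to the intended predicate.

  data Term (n : ℕ) : Set ℓ where
    var            : Fin n → Term n
    con            : V → Term n
    pair           : Term n → Term n → Term n
    _∪ᵗ_ _∩ᵗ_ _∖ᵗ_ : Term n → Term n → Term n

  data Fm : ℕ → Set ℓ where
    _∈ᶠ_ _≡ᶠ_      : ∀ {n} → Term n → Term n → Fm n
    ¬ᶠ_            : ∀ {n} → Fm n → Fm n
    _∧ᶠ_ _∨ᶠ_ _⇒ᶠ_ : ∀ {n} → Fm n → Fm n → Fm n
    ∀ᶠ_ ∃ᶠ_        : ∀ {n} → Fm (suc n) → Fm n
    letᶠ           : ∀ {n} → Term n → Fm (suc n) → Fm n
    _[_]           : ∀ {n m} → Fm m → Vec (Fin n) m → Fm n

  ⟦_⟧ᵗ : ∀ {n} → Term n → Vec V n → V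
  ⟦ var i ⟧ᵗ    ρ = lookup ρ i
  ⟦ con c ⟧ᵗ    ρ = c
  ⟦ pair s t ⟧ᵗ ρ = ｛ ⟦ s ⟧ᵗ ρ , ⟦ t ⟧ᵗ ρ ｝
  ⟦ s ∪ᵗ t ⟧ᵗ   ρ = ⟦ s ⟧ᵗ ρ ∪ ⟦ t ⟧ᵗ ρ
  ⟦ s ∩ᵗ t ⟧ᵗ   ρ = ⟦ s ⟧ᵗ ρ ∩ ⟦ t ⟧ᵗ ρ
  ⟦ s ∖ᵗ t ⟧ᵗ   ρ = ⟦ s ⟧ᵗ ρ ∖ ⟦ t ⟧ᵗ ρ

  ⟦_⟧ : ∀ {n} → Fm n → Vec V n → Set ℓ
  ⟦ s ∈ᶠ t ⟧   ρ = ⟦ s ⟧ᵗ ρ ∈ ⟦ t ⟧ᵗ ρ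
  ⟦ s ≡ᶠ t ⟧   ρ = ⟦ s ⟧ᵗ ρ ≡ ⟦ t ⟧ᵗ ρ
  ⟦ ¬ᶠ φ ⟧     ρ = ¬ ⟦ φ ⟧ ρ
  ⟦ φ ∧ᶠ ψ ⟧   ρ = ⟦ φ ⟧ ρ × ⟦ ψ ⟧ ρ
  ⟦ φ ∨ᶠ ψ ⟧   ρ = ⟦ φ ⟧ ρ ⊎ ⟦ ψ ⟧ ρ
  ⟦ φ ⇒ᶠ ψ ⟧   ρ = ⟦ φ ⟧ ρ → ⟦ ψ ⟧ ρ
  ⟦ ∀ᶠ φ ⟧     ρ = ∀ x → ⟦ φ ⟧ (x ∷ ρ)
  ⟦ ∃ᶠ φ ⟧     ρ = ∃[ x ] ⟦ φ ⟧ (x ∷ ρ)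
  ⟦ letᶠ t φ ⟧ ρ = ⟦ φ ⟧ (⟦ t ⟧ᵗ ρ ∷ ρ)
  ⟦ φ [ σ ] ⟧  ρ = ⟦ φ ⟧ (tabulate (λ i → lookup ρ (lookup σ i)))

  term-definable : ∀ {n} (t : Term n) → DefinableTerm ⟦ t ⟧ᵗ
  term-definable (var i) =
    definable-resp (λ { (_ ∷ _) → ⇔-refl }) (definable-∈ 0F (suc i))
  term-definable (con c) =
    definable-resp (λ { (_ ∷ _) → ⇔-refl }) (definable-∈-constant 0F c)
  term-definable (pair s t) =
    definable-resp (λ _ → ⇔-sym ∈｛,｝)
      (definable-∨ (definable-≡ {T = ⟦ s ⟧ᵗ} (term-definable s))
                   (definable-≡ {T = ⟦ t ⟧ᵗ} (term-definable t)))
  term-definable (s ∪ᵗ t) =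
    definable-resp (λ _ → ⇔-sym ∈∪) (definable-∨ (term-definable s) (term-definable t))
  term-definable (s ∩ᵗ t) =
    definable-resp (λ _ → ⇔-sym ∈∩) (definable-∧ (term-definable s) (term-definable t))
  term-definable (s ∖ᵗ t) =
    definable-resp (λ _ → ⇔-sym ∈∖) (definable-∧ (term-definable s) (definable-¬ (term-definable t)))

  definable : ∀ {n} (φ : Fm n) → Definable ⟦ φ ⟧
  definable (s ∈ᶠ t)   = definable-let (term-definable s) (term-definable t)
  definable (s ≡ᶠ t)   = definable-let (term-definable s) (definable-≡ (term-definable t))
  definable (¬ᶠ φ)     = definable-¬ (definable φ)
  definable (φ ∧ᶠ ψ)   = definable-∧ (definable φ) (definable ψ)
  definable (φ ∨ᶠ ψ)   = definable-∨ (definable φ) (definable ψ)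
  definable (φ ⇒ᶠ ψ)   = definable-⇒ (definable φ) (definable ψ)
  definable (∀ᶠ φ)     = definable-∀ (definable φ)
  definable (∃ᶠ φ)     = definable-∃ (definable φ)
  definable (letᶠ t φ) = definable-let (term-definable t) (definable φ)
  definable (φ [ σ ])  = definable-rename (lookup σ) (definable φ)

  opaque
    sep : V → Fm 1 → V
    sep a φ = proj₁ (separation (formula d (λ _ → 0F) suc) (params d) a)
      where
        d : Definable ⟦ φ ⟧
        d = definable φ

    ∈sep : ∀ {a} φ {x} → x ∈ sep a φ ⇔ (x ∈ a × ⟦ φ ⟧ (x ∷ []))
    ∈sep {a} φ {x} = ⇔-trans (proj₂ (separation (formula d (λ _ → 0F) suc) (params d) a) x)
      (⇔-refl ×-⇔ correct d (x ∷ params d) (λ _ → 0F) suc (λ _ → refl))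
      where
        d : Definable ⟦ φ ⟧
        d = definable φ

  v0 : ∀ {n} → Term (1 +ℕ n)
  v0 = var 0F
  v1 : ∀ {n} → Term (2 +ℕ n)
  v1 = var 1F
  v2 : ∀ {n} → Term (3 +ℕ n)
  v2 = var 2F
  v3 : ∀ {n} → Term (4 +ℕ n)
  v3 = var 3F
  v4 : ∀ {n} → Term (5 +ℕ n)
  v4 = var 4F

  ⟨_,_⟩ᵗ : ∀ {n} → Term n → Term n → Term n
  ⟨ s , t ⟩ᵗ = pair (pair s s) (pair s t)

  wk : ∀ {n} → Term n → Term (1 +ℕ n)
  wk (var i)    = var (suc i)
  wk (con c)    = con c
  wk (pair s t) = pair (wk s) (wk t)
  wk (s ∪ᵗ t)   = wk s ∪ᵗ wk t
  wk (s ∩ᵗ t)   = wk s ∩ᵗ wk t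
  wk (s ∖ᵗ t)   = wk s ∖ᵗ wk t

  infix 8 _⊆ᶠ_
  _⊆ᶠ_ : ∀ {n} → Term n → Term n → Fm n
  s ⊆ᶠ t = ∀ᶠ (v0 ∈ᶠ wk s ⇒ᶠ v0 ∈ᶠ wk t)

  -- Elementary set theory and functions given by formulas.

  by-contradiction : {A : Set ℓ} → ¬ ¬ A → A
  by-contradiction {A} h with em {A}
  ... | yes a = a
  ... | no ¬a = ⊥-elim (h ¬a)

  ∉∅ : ∀ {x} → ¬ x ∈ ∅
  ∉∅ {x} = proj₂ empty x

  infixl 6 _⊕_
  _⊕_ : V → V → V
  s ⊕ a = s ∪ ｛ a , a ｝

  ∈⊕ : ∀ {x s a} → x ∈ s ⊕ a ⇔ (x ∈ s ⊎ x ≡ a)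
  ∈⊕ = mk⇔
    (λ h → [ inj₁ , (λ q → inj₂ ([ id , id ]′ (to ∈｛,｝ q))) ]′ (to ∈∪ h))
    (λ h → from ∈∪ ([ inj₁ , (λ q → inj₂ (from ∈｛,｝ (inj₁ q))) ]′ h))

  ⊕-old : ∀ {x s a} → x ∈ s → x ∈ s ⊕ a
  ⊕-old = from ∈⊕ ∘ inj₁

  ⊕-new : ∀ {s a} → a ∈ s ⊕ a
  ⊕-new = from ∈⊕ (inj₂ refl)

  ∖⊕ : ∀ {s a} → a ∈ s → s ≡ (s ∖ ｛ a , a ｝) ⊕ a
  ∖⊕ {s} {a} a∈s = ext
    (λ z z∈s → case em {z ≡ a} of λ where
      (yes refl) → ⊕-new
      (no z≢a)   → ⊕-old (from ∈∖ (z∈s , λ q → z≢a ([ id , id ]′ (to ∈｛,｝ q)))))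
    (λ z h → case to ∈⊕ h of λ where
      (inj₁ q)    → proj₁ (to ∈∖ q)
      (inj₂ refl) → a∈s)

  ∈-∖｛｝ : ∀ {x s a} → x ∈ s ∖ ｛ a , a ｝ ⇔ (x ∈ s × x ≢ a)
  ∈-∖｛｝ = mk⇔
    (λ h → let p , q = to ∈∖ h in p , λ r → q (from ∈｛,｝ (inj₁ r)))
    (λ (p , q) → from ∈∖ (p , λ r → q ([ id , id ]′ (to ∈｛,｝ r))))

  ⊕-absorb : ∀ {s a} → a ∈ s → s ⊕ a ≡ s
  ⊕-absorb a∈s = ext (λ z h → [ id , (λ { refl → a∈s }) ]′ (to ∈⊕ h)) (λ z → ⊕-old)

  ∈-irrefl : ∀ {x} → ¬ x ∈ x
  ∈-irrefl {x} h with foundation ｛ x , x ｝ (x , from ∈｛,｝ (inj₁ refl))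
  ... | y , y∈ , q with to ∈｛,｝ y∈
  ... | inj₁ refl = q x h (from ∈｛,｝ (inj₁ refl))
  ... | inj₂ refl = q x h (from ∈｛,｝ (inj₁ refl))

  ∈-asym : ∀ {x y} → x ∈ y → ¬ y ∈ x
  ∈-asym {x} {y} p q with foundation ｛ x , y ｝ (x , from ∈｛,｝ (inj₁ refl))
  ... | z , z∈ , h with to ∈｛,｝ z∈
  ... | inj₁ refl = h y q (from ∈｛,｝ (inj₂ refl))
  ... | inj₂ refl = h x p (from ∈｛,｝ (inj₁ refl))

  ｛｝-injective : ∀ {x y z} → ｛ x , x ｝ ≡ ｛ y , z ｝ → x ≡ y × x ≡ z
  ｛｝-injective {x} {y} {z} h =
      sym ([ id , id ]′ (to ∈｛,｝ (subst (y ∈_) (sym h) (from ∈｛,｝ (inj₁ refl)))))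
    , sym ([ id , id ]′ (to ∈｛,｝ (subst (z ∈_) (sym h) (from ∈｛,｝ (inj₂ refl)))))

  ⟨,⟩-injective : ∀ {x y x′ y′} → ⟨ x , y ⟩ ≡ ⟨ x′ , y′ ⟩ → x ≡ x′ × y ≡ y′
  ⟨,⟩-injective {x} {y} {x′} {y′} h = x≡ , y≡ x≡
    where
      x≡ : x ≡ x′
      x≡ with to ∈｛,｝ (subst (｛ x , x ｝ ∈_) h (from ∈｛,｝ (inj₁ refl)))
      ... | inj₁ p = proj₁ (｛｝-injective p)
      ... | inj₂ p = proj₁ (｛｝-injective p)
      second : ∀ {a b c} → ⟨ a , b ⟩ ≡ ⟨ a , c ⟩ → b ≡ c ⊎ b ≡ a
      second {a} {b} {c} q with to ∈｛,｝ (subst (｛ a , b ｝ ∈_) q (from ∈｛,｝ (inj₂ refl)))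
      ... | inj₁ p = inj₂ (sym (proj₂ (｛｝-injective (sym p))))
      ... | inj₂ p with to ∈｛,｝ (subst (b ∈_) p (from ∈｛,｝ (inj₂ refl)))
      ... | inj₁ r = inj₂ r
      ... | inj₂ r = inj₁ r
      y≡ : x ≡ x′ → y ≡ y′
      y≡ refl with second h | second (sym h)
      ... | inj₁ p | _      = p
      ... | inj₂ _ | inj₁ p = sym p
      ... | inj₂ p | inj₂ q = trans p (sym q)

  𝒫 : V → V
  𝒫 x = proj₁ (power x)

  ∈𝒫 : ∀ {x y} → y ∈ 𝒫 x ⇔ y ⊆ x
  ∈𝒫 {x} {y} = proj₂ (power x) y

  opaque
    -- A Kuratowski pair over `A` and `B` is a set of subsets of `A ∪ B`, hence the double power set
    -- as ambient set.
    graph : V → V → Fm 2 → V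
    graph A B φ = sep (𝒫 (𝒫 (A ∪ B)))
      (∃ᶠ ∃ᶠ (v1 ∈ᶠ con A ∧ᶠ v0 ∈ᶠ con B ∧ᶠ v2 ≡ᶠ ⟨ v1 , v0 ⟩ᵗ ∧ᶠ φ [ 1F ∷ 0F ∷ [] ]))

    ∈graph : ∀ {A B} φ {x y} →
             ⟨ x , y ⟩ ∈ graph A B φ ⇔ (x ∈ A × y ∈ B × ⟦ φ ⟧ (x ∷ y ∷ []))
    ∈graph {A} {B} φ {x} {y} = mk⇔
      (λ h → case to (∈sep _) h of λ (_ , x′ , y′ , x∈ , y∈ , e , p) →
        case ⟨,⟩-injective e of λ { (refl , refl) → x∈ , y∈ , p })
      (λ (x∈ , y∈ , p) → from (∈sep _)
        ( from ∈𝒫 (λ u u∈ → from ∈𝒫 (λ v v∈ → case to ∈｛,｝ u∈ of λ where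
            (inj₁ refl) → [ in-A x∈ , in-A x∈ ]′ (to ∈｛,｝ v∈)
            (inj₂ refl) → [ in-A x∈ , in-B y∈ ]′ (to ∈｛,｝ v∈)))
        , x , y , x∈ , y∈ , refl , p))
      where
        in-A : ∀ {v x} → x ∈ A → v ≡ x → v ∈ A ∪ B
        in-A x∈ refl = from ∈∪ (inj₁ x∈)
        in-B : ∀ {v y} → y ∈ B → v ≡ y → v ∈ A ∪ B
        in-B y∈ refl = from ∈∪ (inj₂ y∈)

    graph-pairs : ∀ {A B} φ p → p ∈ graph A B φ → ∃[ x ] ∃[ y ] (x ∈ A × p ≡ ⟨ x , y ⟩)
    graph-pairs φ p h = case to (∈sep _) h of λ (_ , x , y , x∈ , _ , e , _) → x , y , x∈ , e

  module _ {A B : V} (φ : Fm 2)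
           (total      : ∀ x → x ∈ A → ∃[ y ] (y ∈ B × ⟦ φ ⟧ (x ∷ y ∷ [])))
           (functional : ∀ x y y′ → x ∈ A → y ∈ B → y′ ∈ B →
                         ⟦ φ ⟧ (x ∷ y ∷ []) → ⟦ φ ⟧ (x ∷ y′ ∷ []) → y ≡ y′) where

    graph-map : graph A B φ ∶ A ⟶ B
    graph-map = (graph-pairs φ , λ x x∈ → case total x x∈ of λ (y , y∈ , p) →
        y , from (∈graph φ) (x∈ , y∈ , p) , λ {_} h → case to (∈graph φ) h of λ (_ , y′∈ , p′) →
          functional x _ _ x∈ y∈ y′∈ p p′)
      , λ x y h → proj₁ (proj₂ (to (∈graph φ) h))

    graph-injection : (∀ x x′ y → x ∈ A → x′ ∈ A → y ∈ B →
                       ⟦ φ ⟧ (x ∷ y ∷ []) → ⟦ φ ⟧ (x′ ∷ y ∷ []) → x ≡ x′) →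
                      graph A B φ ∶ A ↣ B
    graph-injection inj = graph-map , λ x x′ y h h′ →
      case to (∈graph φ) h , to (∈graph φ) h′ of λ ((x∈ , y∈ , p) , (x′∈ , _ , p′)) →
        inj x x′ y x∈ x′∈ y∈ p p′

    graph-surjection : (∀ y → y ∈ B → ∃[ x ] (x ∈ A × ⟦ φ ⟧ (x ∷ y ∷ []))) →
                       graph A B φ ∶ A ↠ B
    graph-surjection sur = graph-map , λ y y∈ → case sur y y∈ of λ (x , x∈ , p) →
      x , from (∈graph φ) (x∈ , y∈ , p)

  module _ {f A : V} (F : FunctionOn f A) where

    value : ∀ {x} → x ∈ A → ∃[ y ] ⟨ x , y ⟩ ∈ f
    value x∈ = case proj₂ F _ x∈ of λ (y , h , _) → y , h

    argument : ∀ {x y} → ⟨ x , y ⟩ ∈ f → x ∈ A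
    argument h = case proj₁ F _ h of λ (x , y , x∈ , e) → case ⟨,⟩-injective e of λ { (refl , _) → x∈ }

    value-unique : ∀ {x y y′} → ⟨ x , y ⟩ ∈ f → ⟨ x , y′ ⟩ ∈ f → y ≡ y′
    value-unique h h′ = case proj₂ F _ (argument h) of λ (_ , _ , u) → trans (sym (u h)) (u h′)

  -- Finite sets, in the sense of Kuratowski.

  opaque
    fin : Fm 1
    fin = ∀ᶠ (con ∅ ∈ᶠ v0
          ⇒ᶠ (∀ᶠ ∀ᶠ (v1 ∈ᶠ v2 ⇒ᶠ v0 ∈ᶠ v3 ⇒ᶠ v1 ∪ᵗ pair v0 v0 ∈ᶠ v2))
          ⇒ᶠ v1 ∈ᶠ v0)

  IsFinite : V → Set ℓ
  IsFinite s = ⟦ fin ⟧ (s ∷ [])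

  opaque
    unfolding fin

    finite-∅ : IsFinite ∅
    finite-∅ 𝓕 h _ = h

    finite-⊕ : ∀ {s a} → IsFinite s → IsFinite (s ⊕ a)
    finite-⊕ h 𝓕 p q = q _ _ (h 𝓕 p λ t b t∈ b∈ → q t b t∈ (⊕-old b∈)) ⊕-new

    -- Finiteness of `s` is applied to the set of all finite `t ⊆ s` that satisfy `φ`. Carrying
    -- `fin` along hands finiteness of `t` to the step, and adding an element already present
    -- changes nothing, so the step may assume it new.
    finite-induction : ∀ (φ : Fm 1) {s} → IsFinite s → ⟦ φ ⟧ (∅ ∷ []) →
      (∀ t a → IsFinite t → ¬ a ∈ t → ⟦ φ ⟧ (t ∷ []) → ⟦ φ ⟧ (t ⊕ a ∷ [])) → ⟦ φ ⟧ (s ∷ [])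
    finite-induction φ {s} h base step =
      proj₁ (proj₂ (to (∈sep ψ) (h (sep (𝒫 s) ψ)
        (from (∈sep ψ) (from ∈𝒫 (λ _ → ⊥-elim ∘ ∉∅) , base , finite-∅))
        λ t a t∈ a∈s → case to (∈sep ψ) t∈ of λ (t⊆ , p , f) → from (∈sep ψ)
          ( from ∈𝒫 (λ z z∈ → [ to ∈𝒫 t⊆ z , (λ { refl → a∈s }) ]′ (to ∈⊕ z∈))
          , (case em {a ∈ t} of λ where
              (yes a∈t) → subst (λ u → ⟦ φ ⟧ (u ∷ [])) (sym (⊕-absorb a∈t)) p
              (no a∉t)  → step t a f a∉t p)
          , finite-⊕ f))))
      where
        ψ : Fm 1
        ψ = φ ∧ᶠ fin

  finite-⊆ : ∀ {s} → IsFinite s → ∀ {t} → t ⊆ s → IsFinite t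
  finite-⊆ h {t} = finite-induction (∀ᶠ (v0 ⊆ᶠ v1 ⇒ᶠ fin [ 0F ∷ [] ])) h
    (λ t t⊆∅ → subst IsFinite (ext (λ _ → ⊥-elim ∘ ∉∅) t⊆∅) finite-∅)
    (λ s a _ _ ih t t⊆ → case em {a ∈ t} of λ where
      (yes a∈t) → subst IsFinite (sym (∖⊕ a∈t)) (finite-⊕ (ih _ λ z z∈ →
        case to ∈-∖｛｝ z∈ of λ (z∈t , z≢a) → [ id , ⊥-elim ∘ z≢a ]′ (to ∈⊕ (t⊆ z z∈t))))
      (no a∉t) → ih t λ z z∈ → [ id , (λ { refl → ⊥-elim (a∉t z∈) }) ]′ (to ∈⊕ (t⊆ z z∈)))
    t

  finite-∪ : ∀ {s t} → IsFinite s → IsFinite t → IsFinite (s ∪ t)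
  finite-∪ {s} {t} h h′ = finite-induction (letᶠ (con s ∪ᵗ v0) (fin [ 0F ∷ [] ])) h′
    (finite-⊆ h λ z z∈ → [ id , ⊥-elim ∘ ∉∅ ]′ (to ∈∪ z∈))
    (λ u a _ _ ih → finite-⊆ (finite-⊕ ih) λ z z∈ → case to ∈∪ z∈ of λ where
      (inj₁ z∈s) → ⊕-old (from ∈∪ (inj₁ z∈s))
      (inj₂ z∈u) → case to ∈⊕ z∈u of λ where
        (inj₁ z∈u) → ⊕-old (from ∈∪ (inj₂ z∈u))
        (inj₂ refl) → ⊕-new)

  -- Choice from finitely many bounds is provable by induction. An upper bound instead of the exact
  -- union lets `R` be any formula; when `R` is functional, this is finiteness of images.
  finite-⋃ : ∀ (R : Fm 2) {s} → IsFinite s →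
    (∀ k → k ∈ s → ∃[ t ] (IsFinite t × (∀ x → ⟦ R ⟧ (k ∷ x ∷ []) → x ∈ t))) →
    ∃[ t ] (IsFinite t × (∀ k → k ∈ s → ∀ x → ⟦ R ⟧ (k ∷ x ∷ []) → x ∈ t))
  finite-⋃ R {s} h = finite-induction
    ((∀ᶠ (v0 ∈ᶠ v1 ⇒ᶠ ∃ᶠ (fin [ 0F ∷ [] ] ∧ᶠ (∀ᶠ (R [ 2F ∷ 0F ∷ [] ] ⇒ᶠ v0 ∈ᶠ v1))))) ⇒ᶠ
     (∃ᶠ (fin [ 0F ∷ [] ] ∧ᶠ (∀ᶠ (v0 ∈ᶠ v2 ⇒ᶠ ∀ᶠ (R [ 1F ∷ 0F ∷ [] ] ⇒ᶠ v0 ∈ᶠ v2))))))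
    h
    (λ _ → ∅ , finite-∅ , λ _ → ⊥-elim ∘ ∉∅)
    (λ t a _ _ ih each → case ih (λ k k∈ → each k (⊕-old k∈)) , each a ⊕-new of λ
      ((u , fu , pu) , (w , fw , pw)) → u ∪ w , finite-∪ fu fw , λ k k∈ x r →
        from ∈∪ (case to ∈⊕ k∈ of λ where
        (inj₁ k∈)   → inj₁ (pu k k∈ x r)
        (inj₂ refl) → inj₂ (pw x r)))

  -- A subset of `t ⊕ a` either omits `a` or is `k ⊕ a` with `k ⊆ t`; the sets of the second kind
  -- are the images of members of `P`.
  finite-𝒫 : ∀ {s} → IsFinite s → ∃[ P ] (IsFinite P × (∀ u → u ⊆ s → u ∈ P))
  finite-𝒫 h = finite-induction (∃ᶠ (fin [ 0F ∷ [] ] ∧ᶠ (∀ᶠ (v0 ⊆ᶠ v2 ⇒ᶠ v0 ∈ᶠ v1)))) h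
    (∅ ⊕ ∅ , finite-⊕ finite-∅ , λ u u⊆ → subst (_∈ ∅ ⊕ ∅) (ext (λ _ → ⊥-elim ∘ ∉∅) u⊆) ⊕-new)
    (λ t a _ _ (P , fP , p) →
      case finite-⋃ (v1 ≡ᶠ v0 ∪ᵗ pair (con a) (con a)) fP
             (λ k _ → ∅ ⊕ (k ⊕ a) , finite-⊕ finite-∅ , λ { x refl → ⊕-new }) of λ
        (Q , fQ , q) → P ∪ Q , finite-∪ fP fQ , λ u u⊆ → from ∈∪ (case em {a ∈ u} of λ where
          (yes a∈u) → inj₂ (q (u ∖ ｛ a , a ｝) (p _ λ z z∈ → case to ∈-∖｛｝ z∈ of λ (z∈u , z≢a) →
                        [ id , ⊥-elim ∘ z≢a ]′ (to ∈⊕ (u⊆ z z∈u))) u (∖⊕ a∈u))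
          (no a∉u)  → inj₁ (p u λ z z∈ → [ id , (λ { refl → ⊥-elim (a∉u z∈) }) ]′ (to ∈⊕ (u⊆ z z∈)))))

  Chain : V → Set ℓ
  Chain 𝒞 = ∀ c c′ → c ∈ 𝒞 → c′ ∈ 𝒞 → c ⊆ c′ ⊎ c′ ⊆ c

  -- The compactness behind every limit argument: finitely many points spread over a chain already
  -- lie in one member.
  finite-⊆-chain : ∀ {𝒞 t} → Chain 𝒞 → ∃[ c ] c ∈ 𝒞 → IsFinite t →
    (∀ x → x ∈ t → ∃[ c ] (c ∈ 𝒞 × x ∈ c)) → ∃[ c ] (c ∈ 𝒞 × t ⊆ c)
  finite-⊆-chain {𝒞} chain (c₀ , c₀∈) h = finite-induction
    ((∀ᶠ (v0 ∈ᶠ v1 ⇒ᶠ ∃ᶠ (v0 ∈ᶠ con 𝒞 ∧ᶠ v1 ∈ᶠ v0))) ⇒ᶠ ∃ᶠ (v0 ∈ᶠ con 𝒞 ∧ᶠ v1 ⊆ᶠ v0)) h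
    (λ _ → c₀ , c₀∈ , λ _ → ⊥-elim ∘ ∉∅)
    (λ t a _ _ ih cover → case ih (λ x x∈ → cover x (⊕-old x∈)) , cover a ⊕-new of λ
      ((c , c∈ , t⊆c) , (c′ , c′∈ , a∈c′)) → case chain c c′ c∈ c′∈ of λ where
        (inj₁ q) → c′ , c′∈ , λ z z∈ → [ q z ∘ t⊆c z , (λ { refl → a∈c′ }) ]′ (to ∈⊕ z∈)
        (inj₂ q) → c , c∈ , λ z z∈ → [ t⊆c z , (λ { refl → q _ a∈c′ }) ]′ (to ∈⊕ z∈))

  -- Supplies the bounds that `finite-⋃` asks for when a relation is functional.
  subsingleton-finite : (P : V → Set ℓ) → (∀ x y → P x → P y → x ≡ y) →
                        ∃[ t ] (IsFinite t × (∀ x → P x → x ∈ t))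
  subsingleton-finite P unique with em {∃ P}
  ... | yes (a , pa) = ∅ ⊕ a , finite-⊕ finite-∅ , λ x px → from ∈⊕ (inj₂ (unique x a px pa))
  ... | no ¬∃        = ∅ , finite-∅ , λ x px → ⊥-elim (¬∃ (x , px))

  -- Successors, ordinals, `ω` and `ω₁`.

  ⁺-injective : ∀ {x y} → x ⁺ ≡ y ⁺ → x ≡ y
  ⁺-injective {x} {y} h with to ∈⊕ (subst (x ∈_) h ⊕-new) | to ∈⊕ (subst (y ∈_) (sym h) ⊕-new)
  ... | inj₂ p | _      = p
  ... | inj₁ _ | inj₂ q = sym q
  ... | inj₁ p | inj₁ q = ⊥-elim (∈-asym p q)

  ∅≢⁺ : ∀ {x} → ∅ ≢ x ⁺
  ∅≢⁺ {x} h = ∉∅ (subst (x ∈_) (sym h) ⊕-new)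

  empty-or-inhabited : ∀ s → s ≡ ∅ ⊎ ∃[ x ] x ∈ s
  empty-or-inhabited s with em {∃[ x ] x ∈ s}
  ... | yes h = inj₂ h
  ... | no ¬h = inj₁ (ext (λ x h → ⊥-elim (¬h (x , h))) (λ _ → ⊥-elim ∘ ∉∅))

  module OrdinalProperties {o : V} (ordinal : Ordinal o) where

    member-⊆ : ∀ {x} → x ∈ o → x ⊆ o
    member-⊆ = proj₁ ordinal _

    ∈-trans : ∀ {x y z} → z ∈ o → x ∈ y → y ∈ z → x ∈ z
    ∈-trans z∈ p q = let y∈ = member-⊆ z∈ _ q in
      proj₁ (proj₂ (proj₂ ordinal)) _ _ _ (member-⊆ y∈ _ p) y∈ z∈ p q

    compare : ∀ {x y} → x ∈ o → y ∈ o → x ∈ y ⊎ x ≡ y ⊎ y ∈ x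
    compare = proj₁ (proj₂ (proj₂ (proj₂ ordinal))) _ _

    ∉⇒⊆ : ∀ {x y} → x ∈ o → y ∈ o → ¬ x ∈ y → y ⊆ x
    ∉⇒⊆ x∈ y∈ x∉y z z∈y with compare x∈ y∈
    ... | inj₁ p           = ⊥-elim (x∉y p)
    ... | inj₂ (inj₁ refl) = z∈y
    ... | inj₂ (inj₂ p)    = ∈-trans x∈ z∈y p

    -- The source of canonical witnesses: together with `least-unique` it turns existence among
    -- ordinals into a definable function.
    least : ∀ (φ : Fm 1) → ∃[ x ] (x ∈ o × ⟦ φ ⟧ (x ∷ [])) →
            ∃[ m ] (m ∈ o × ⟦ φ ⟧ (m ∷ []) × (∀ x → x ∈ o → ⟦ φ ⟧ (x ∷ []) → ¬ x ∈ m))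
    least φ (x , x∈ , p) =
      case proj₂ (proj₂ (proj₂ (proj₂ ordinal))) (sep o φ) (λ z → proj₁ ∘ to (∈sep φ))
             (x , from (∈sep φ) (x∈ , p)) of λ
        (m , m∈ , h) → m , proj₁ (to (∈sep φ) m∈) , proj₂ (to (∈sep φ) m∈) , λ y y∈ q y∈m →
          case h y (from (∈sep φ) (y∈ , q)) of λ where
            (inj₁ refl) → ∈-irrefl y∈m
            (inj₂ m∈y)  → ∈-asym m∈y y∈m

    least-unique : ∀ (P : V → Set ℓ) {m m′} →
      m ∈ o × P m × (∀ x → x ∈ o → P x → ¬ x ∈ m) →
      m′ ∈ o × P m′ × (∀ x → x ∈ o → P x → ¬ x ∈ m′) → m ≡ m′
    least-unique P {m} {m′} (m∈ , p , h) (m′∈ , p′ , h′) with compare m∈ m′∈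
    ... | inj₁ q        = ⊥-elim (h′ m m∈ p q)
    ... | inj₂ (inj₁ q) = q
    ... | inj₂ (inj₂ q) = ⊥-elim (h m′ m′∈ p′ q)

  module OmegaOne {ω ω₁ : V} (isω : IsOmega ω) (isω₁ : IsOmega₁ ω ω₁) where

    open OrdinalProperties (proj₁ isω₁) public

    ∅∈ω : ∅ ∈ ω
    ∅∈ω = proj₁ (proj₁ isω)

    ⁺∈ω : ∀ {k} → k ∈ ω → k ⁺ ∈ ω
    ⁺∈ω = proj₂ (proj₁ isω) _

    ω-induction : ∀ (φ : Fm 1) → ⟦ φ ⟧ (∅ ∷ []) →
      (∀ k → k ∈ ω → ⟦ φ ⟧ (k ∷ []) → ⟦ φ ⟧ (k ⁺ ∷ [])) → ∀ {k} → k ∈ ω → ⟦ φ ⟧ (k ∷ [])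
    ω-induction φ base step {k} k∈ = proj₂ (to (∈sep φ) (proj₂ isω (sep ω φ)
      ( from (∈sep φ) (∅∈ω , base)
      , λ x x∈ → case to (∈sep φ) x∈ of λ (x∈ω , p) → from (∈sep φ) (⁺∈ω x∈ω , step x x∈ω p)) k k∈))

    zero-or-suc : ∀ {k} → k ∈ ω → k ≡ ∅ ⊎ ∃[ j ] (j ∈ ω × k ≡ j ⁺)
    zero-or-suc = ω-induction (v0 ≡ᶠ con ∅ ∨ᶠ ∃ᶠ (v0 ∈ᶠ con ω ∧ᶠ v1 ≡ᶠ v0 ∪ᵗ pair v0 v0))
      (inj₁ refl) (λ k k∈ _ → inj₂ (k , k∈ , refl))

    ∅∈ω₁ : ∅ ∈ ω₁
    ∅∈ω₁ with empty-or-inhabited ω₁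
    ... | inj₁ refl = ⊥-elim (proj₁ (proj₂ isω₁) (_ , graph-injection (v0 ∈ᶠ con ∅)
            (λ _ → ⊥-elim ∘ ∉∅) (λ _ _ _ h → ⊥-elim (∉∅ h)) (λ _ _ _ h → ⊥-elim (∉∅ h))))
    ... | inj₂ (x , x∈) with least (con ∅ ≡ᶠ con ∅) (x , x∈ , refl)
    ... | m , m∈ , _ , h = subst (_∈ ω₁)
            (ext (λ z z∈ → ⊥-elim (h z (member-⊆ m∈ z z∈) refl z∈)) (λ _ → ⊥-elim ∘ ∉∅)) m∈

    -- The new point goes to `∅` and all other values are shifted up by one.
    ⁺-countable : ∀ {x} → Countable ω x → Countable ω (x ⁺)
    ⁺-countable {x} (f , (F , f∈ω) , f-inj) = _ , graph-injection
      (v0 ≡ᶠ con x ∧ᶠ v1 ≡ᶠ con ∅ ∨ᶠ ∃ᶠ (⟨ v1 , v0 ⟩ᵗ ∈ᶠ con f ∧ᶠ v2 ≡ᶠ v0 ∪ᵗ pair v0 v0))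
      (λ y y∈ → case to ∈⊕ y∈ of λ where
        (inj₁ y∈x) → case value F y∈x of λ (j , h) → j ⁺ , ⁺∈ω (f∈ω _ _ h) , inj₂ (j , h , refl)
        (inj₂ refl) → ∅ , ∅∈ω , inj₁ (refl , refl))
      (λ where
        _ _ _ _ _ _ (inj₁ (refl , refl)) (inj₁ (_ , refl))       → refl
        _ _ _ _ _ _ (inj₁ (refl , refl)) (inj₂ (_ , h , refl))   → ⊥-elim (∈-irrefl (argument F h))
        _ _ _ _ _ _ (inj₂ (_ , h , refl)) (inj₁ (refl , refl))   → ⊥-elim (∈-irrefl (argument F h))
        _ _ _ _ _ _ (inj₂ (_ , h , refl)) (inj₂ (_ , h′ , refl)) → cong _⁺ (value-unique F h h′))
      (λ where
        _ _ _ _ _ _ (inj₁ (refl , _)) (inj₁ (refl , _))       → refl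
        _ _ _ _ _ _ (inj₁ (_ , refl)) (inj₂ (_ , _ , e))      → ⊥-elim (∅≢⁺ e)
        _ _ _ _ _ _ (inj₂ (_ , _ , refl)) (inj₁ (_ , e))      → ⊥-elim (∅≢⁺ (sym e))
        _ _ _ _ _ _ (inj₂ (_ , h , refl)) (inj₂ (_ , h′ , e)) → f-inj _ _ _ h
          (subst (λ k → ⟨ _ , k ⟩ ∈ f) (⁺-injective (sym e)) h′))

    -- The least ordinal of `ω₁` above `x` is `x ⁺`; if there were none above `x`, then `ω₁` would
    -- be `x ⁺`, which is countable.
    ⁺∈ω₁ : ∀ {x} → x ∈ ω₁ → x ⁺ ∈ ω₁
    ⁺∈ω₁ {x} x∈ with em {∃[ y ] (y ∈ ω₁ × x ∈ y)}
    ... | yes h = case least (con x ∈ᶠ v0) h of λ (y , y∈ , x∈y , min) →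
      subst (_∈ ω₁) (ext
        (λ z z∈y → let z∈ = member-⊆ y∈ z z∈y in case compare z∈ x∈ of λ where
          (inj₁ p)           → ⊕-old p
          (inj₂ (inj₁ refl)) → ⊕-new
          (inj₂ (inj₂ p))    → ⊥-elim (min z z∈ p z∈y))
        (λ z z∈ → case to ∈⊕ z∈ of λ where
          (inj₁ p)    → ∈-trans y∈ p x∈y
          (inj₂ refl) → x∈y)) y∈
    ... | no ¬h = ⊥-elim (proj₁ (proj₂ isω₁) (subst (Countable ω) (ext
        (λ z z∈ → case to ∈⊕ z∈ of λ where
          (inj₁ p)    → member-⊆ x∈ z p
          (inj₂ refl) → x∈)
        (λ z z∈ → case compare z∈ x∈ of λ where
          (inj₁ p)           → ⊕-old p
          (inj₂ (inj₁ refl)) → ⊕-new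
          (inj₂ (inj₂ p))    → ⊥-elim (¬h (z , z∈ , p))))
      (⁺-countable (proj₂ (proj₂ isω₁) x x∈))))

    -- Through this inclusion `ω` inherits trichotomy, transitivity and least elements from `ω₁`.
    ω⊆ω₁ : ω ⊆ ω₁
    ω⊆ω₁ = proj₂ isω ω₁ (∅∈ω₁ , λ _ → ⁺∈ω₁)

    ω-transitive : ∀ {j k} → k ∈ ω → j ∈ k → j ∈ ω
    ω-transitive {j} k∈ = ω-induction (v0 ⊆ᶠ con ω) (λ _ → ⊥-elim ∘ ∉∅)
      (λ k k∈ h j j∈ → [ h j , (λ { refl → k∈ }) ]′ (to ∈⊕ j∈)) k∈ j

    least-ω : ∀ (φ : Fm 1) → ∃[ k ] (k ∈ ω × ⟦ φ ⟧ (k ∷ [])) →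
              ∃[ m ] (m ∈ ω × ⟦ φ ⟧ (m ∷ []) × (∀ k → k ∈ ω → ⟦ φ ⟧ (k ∷ []) → ¬ k ∈ m))
    least-ω φ (k , k∈ , p) =
      case least (v0 ∈ᶠ con ω ∧ᶠ φ) (k , ω⊆ω₁ k k∈ , k∈ , p) of λ
        (m , _ , (m∈ , q) , min) → m , m∈ , q , λ j j∈ r → min j (ω⊆ω₁ j j∈) (j∈ , r)

    compare-ω : ∀ {j k} → j ∈ ω → k ∈ ω → j ∈ k ⊎ j ≡ k ⊎ k ∈ j
    compare-ω j∈ k∈ = compare (ω⊆ω₁ _ j∈) (ω⊆ω₁ _ k∈)

    finite-∈ω : ∀ {k} → k ∈ ω → IsFinite k
    finite-∈ω = ω-induction fin finite-∅ (λ _ _ → finite-⊕)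

    ⁺∈⁺ : ∀ {j k} → k ∈ ω → j ⁺ ∈ k ⁺ → j ∈ k
    ⁺∈⁺ k∈ h with to ∈⊕ h
    ... | inj₁ p    = ∈-trans (ω⊆ω₁ _ k∈) ⊕-new p
    ... | inj₂ refl = ⊕-new

  -- Finite cardinalities and countable linear orders.

  -- A bijection spelled out in the formula language, with variables for the relation and both sets,
  -- so that equinumerosity may occur in induction predicates.
  matching : Fm 3
  matching =
       (∀ᶠ ∀ᶠ (⟨ v1 , v0 ⟩ᵗ ∈ᶠ v2 ⇒ᶠ v1 ∈ᶠ v3 ∧ᶠ v0 ∈ᶠ v4))
    ∧ᶠ (∀ᶠ (v0 ∈ᶠ v2 ⇒ᶠ ∃ᶠ (⟨ v1 , v0 ⟩ᵗ ∈ᶠ v2)))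
    ∧ᶠ (∀ᶠ (v0 ∈ᶠ v3 ⇒ᶠ ∃ᶠ (⟨ v0 , v1 ⟩ᵗ ∈ᶠ v2)))
    ∧ᶠ (∀ᶠ ∀ᶠ ∀ᶠ (⟨ v2 , v1 ⟩ᵗ ∈ᶠ v3 ⇒ᶠ ⟨ v2 , v0 ⟩ᵗ ∈ᶠ v3 ⇒ᶠ v1 ≡ᶠ v0))
    ∧ᶠ (∀ᶠ ∀ᶠ ∀ᶠ (⟨ v2 , v0 ⟩ᵗ ∈ᶠ v3 ⇒ᶠ ⟨ v1 , v0 ⟩ᵗ ∈ᶠ v3 ⇒ᶠ v2 ≡ᶠ v1))

  opaque
    equinumerous : Fm 2
    equinumerous = ∃ᶠ matching

  infix 4 _≃_
  _≃_ : V → V → Set ℓ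
  s ≃ k = ⟦ equinumerous ⟧ (s ∷ k ∷ [])

  opaque
    unfolding equinumerous

    ≈⇒≃ : ∀ {s k} → s ≈ k → s ≃ k
    ≈⇒≃ (f , ((F , f∈) , inj) , (_ , sur)) =
      f , (λ x y h → argument F h , f∈ x y h) , (λ x x∈ → value F x∈) , sur
        , (λ x y y′ → value-unique F) , inj

    ≃⇒≈ : ∀ {s k} → s ≃ k → s ≈ k
    ≃⇒≈ {s} {k} (R , range , total , sur , fun , inj) = _ ,
      graph-injection φ t f (λ x x′ y _ _ _ → inj x x′ y) ,
      graph-surjection φ t f (λ y y∈ → case sur y y∈ of λ (x , h) → x , proj₁ (range _ _ h) , h)
      where
        φ : Fm 2
        φ = ⟨ v0 , v1 ⟩ᵗ ∈ᶠ con R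
        t : ∀ x → x ∈ s → ∃[ y ] (y ∈ k × ⟦ φ ⟧ (x ∷ y ∷ []))
        t x x∈ = case total x x∈ of λ (y , h) → y , proj₂ (range _ _ h) , h
        f : ∀ x y y′ → x ∈ s → y ∈ k → y′ ∈ k → ⟦ φ ⟧ (x ∷ y ∷ []) → ⟦ φ ⟧ (x ∷ y′ ∷ []) → y ≡ y′
        f x y y′ _ _ _ = fun x y y′

  graph-≃ : ∀ {s k} (φ : Fm 2) →
    (∀ x → x ∈ s → ∃[ y ] (y ∈ k × ⟦ φ ⟧ (x ∷ y ∷ []))) →
    (∀ y → y ∈ k → ∃[ x ] (x ∈ s × ⟦ φ ⟧ (x ∷ y ∷ []))) →
    (∀ x y y′ → x ∈ s → y ∈ k → y′ ∈ k → ⟦ φ ⟧ (x ∷ y ∷ []) → ⟦ φ ⟧ (x ∷ y′ ∷ []) → y ≡ y′) →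
    (∀ x x′ y → x ∈ s → x′ ∈ s → y ∈ k → ⟦ φ ⟧ (x ∷ y ∷ []) → ⟦ φ ⟧ (x′ ∷ y ∷ []) → x ≡ x′) →
    s ≃ k
  graph-≃ φ total sur fun inj =
    ≈⇒≃ (_ , graph-injection φ total fun inj , graph-surjection φ total fun sur)

  ∅≃∅ : ∅ ≃ ∅
  ∅≃∅ = graph-≃ (v0 ∈ᶠ v1) (λ _ → ⊥-elim ∘ ∉∅) (λ _ → ⊥-elim ∘ ∉∅)
    (λ _ _ _ h → ⊥-elim (∉∅ h)) (λ _ _ _ h → ⊥-elim (∉∅ h))

  opaque
    unfolding equinumerous

    ≃∅⇒≡∅ : ∀ {s} → s ≃ ∅ → s ≡ ∅
    ≃∅⇒≡∅ (R , range , total , _) =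
      ext (λ x x∈ → ⊥-elim (∉∅ (proj₂ (range _ _ (proj₂ (total x x∈)))))) (λ _ → ⊥-elim ∘ ∉∅)

    ≃⁺⇒inhabited : ∀ {s k} → s ≃ k ⁺ → ∃[ a ] a ∈ s
    ≃⁺⇒inhabited (R , range , _ , sur , _) =
      case sur _ ⊕-new of λ (a , h) → a , proj₁ (range _ _ h)

    ≃-⊕ : ∀ {s k a} → s ≃ k → ¬ a ∈ s → s ⊕ a ≃ k ⁺
    ≃-⊕ {s} {k} {a} (R , range , total , sur , fun , inj) a∉s = graph-≃
      (⟨ v0 , v1 ⟩ᵗ ∈ᶠ con R ∨ᶠ v0 ≡ᶠ con a ∧ᶠ v1 ≡ᶠ con k)
      (λ x x∈ → case to ∈⊕ x∈ of λ where
        (inj₁ x∈s)  → case total x x∈s of λ (y , h) → y , ⊕-old (proj₂ (range _ _ h)) , inj₁ h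
        (inj₂ refl) → k , ⊕-new , inj₂ (refl , refl))
      (λ y y∈ → case to ∈⊕ y∈ of λ where
        (inj₁ y∈k)  → case sur y y∈k of λ (x , h) → x , ⊕-old (proj₁ (range _ _ h)) , inj₁ h
        (inj₂ refl) → a , ⊕-new , inj₂ (refl , refl))
      (λ where
        x y y′ _ _ _ (inj₁ h) (inj₁ h′)                   → fun x y y′ h h′
        x y y′ _ _ _ (inj₁ h) (inj₂ (refl , refl))        → ⊥-elim (a∉s (proj₁ (range _ _ h)))
        x y y′ _ _ _ (inj₂ (refl , refl)) (inj₁ h)        → ⊥-elim (a∉s (proj₁ (range _ _ h)))
        x y y′ _ _ _ (inj₂ (_ , refl)) (inj₂ (_ , refl))  → refl)
      (λ where
        x x′ y _ _ _ (inj₁ h) (inj₁ h′)                   → inj x x′ y h h′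
        x x′ y _ _ _ (inj₁ h) (inj₂ (refl , refl))        → ⊥-elim (∈-irrefl (proj₂ (range _ _ h)))
        x x′ y _ _ _ (inj₂ (refl , refl)) (inj₁ h)        → ⊥-elim (∈-irrefl (proj₂ (range _ _ h)))
        x x′ y _ _ _ (inj₂ (refl , _)) (inj₂ (refl , _))  → refl)

    -- The element matched with k takes over the partner of a.

    ≃-∖ : ∀ {s k a} → s ≃ k ⁺ → a ∈ s → s ∖ ｛ a , a ｝ ≃ k
    ≃-∖ {s} {k} {a} (R , range , total , sur , fun , inj) a∈s = graph-≃
      (⟨ v0 , v1 ⟩ᵗ ∈ᶠ con R ∨ᶠ ⟨ v0 , con k ⟩ᵗ ∈ᶠ con R ∧ᶠ ⟨ con a , v1 ⟩ᵗ ∈ᶠ con R)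
      (λ x x∈ → case to ∈-∖｛｝ x∈ of λ (x∈s , x≢a) → case total x x∈s , total a a∈s of λ
        ((y , h) , (z , h′)) → case to ∈⊕ (proj₂ (range _ _ h)) of λ where
          (inj₁ y∈k)  → y , y∈k , inj₁ h
          (inj₂ refl) → case to ∈⊕ (proj₂ (range _ _ h′)) of λ where
            (inj₁ z∈k)  → z , z∈k , inj₂ (h , h′)
            (inj₂ refl) → ⊥-elim (x≢a (inj _ _ _ h h′)))
      (λ y y∈k → case sur y (⊕-old y∈k) of λ (x , h) → case em {x ≡ a} of λ where
        (no x≢a)   → x , from ∈-∖｛｝ (proj₁ (range _ _ h) , x≢a) , inj₁ h
        (yes refl) → case sur k ⊕-new of λ (z , h′) →
          z , from ∈-∖｛｝ (proj₁ (range _ _ h′) , λ { refl →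
                ∈-irrefl (subst (_∈ k) (fun _ _ _ h h′) y∈k) }) , inj₂ (h′ , h))
      (λ where
        x y y′ _ _ _ (inj₁ h) (inj₁ h′)              → fun x y y′ h h′
        x y y′ _ y∈ _ (inj₁ h) (inj₂ (h′ , _))       → ⊥-elim (∈-irrefl (subst (_∈ k) (fun _ _ _ h h′) y∈))
        x y y′ _ _ y∈ (inj₂ (h′ , _)) (inj₁ h)       → ⊥-elim (∈-irrefl (subst (_∈ k) (fun _ _ _ h h′) y∈))
        x y y′ _ _ _ (inj₂ (_ , h)) (inj₂ (_ , h′))  → fun _ _ _ h h′)
      (λ where
        x x′ y _ _ _ (inj₁ h) (inj₁ h′)              → inj x x′ y h h′
        x x′ y x∈ _ _ (inj₁ h) (inj₂ (_ , h′))       → ⊥-elim (proj₂ (to ∈-∖｛｝ x∈) (inj _ _ _ h h′))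
        x x′ y _ x∈ _ (inj₂ (_ , h′)) (inj₁ h)       → ⊥-elim (proj₂ (to ∈-∖｛｝ x∈) (inj _ _ _ h h′))
        x x′ y _ _ _ (inj₂ (h , _)) (inj₂ (h′ , _))  → inj _ _ _ h h′)

  ∖-mono : ∀ {s t u} → s ⊆ t → s ∖ u ⊆ t ∖ u
  ∖-mono s⊆t z h = let p , q = to ∈∖ h in from ∈∖ (s⊆t z p , q)

  module Counting {ω ω₁ : V} (isω : IsOmega ω) (isω₁ : IsOmega₁ ω ω₁) where

    open OmegaOne isω isω₁

    -- The pigeonhole principle: a point of `t` is removed from both `s` and `t`, which lowers both
    -- sizes by one.
    ≃-monotone : ∀ {m k s t} → m ∈ ω → k ∈ ω → s ≃ m → t ≃ k → t ⊆ s → ¬ m ∈ k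
    ≃-monotone m∈ k∈ s≃ t≃ = ω-induction
      (∀ᶠ ∀ᶠ ∀ᶠ (v1 ∈ᶠ con ω ⇒ᶠ equinumerous [ 2F ∷ 3F ∷ [] ] ⇒ᶠ equinumerous [ 0F ∷ 1F ∷ [] ]
                 ⇒ᶠ v0 ⊆ᶠ v2 ⇒ᶠ ¬ᶠ v3 ∈ᶠ v1))
      (λ s k t k∈ s≃ t≃ t⊆s m∈k → case zero-or-suc k∈ of λ where
        (inj₁ refl)           → ∉∅ m∈k
        (inj₂ (i , _ , refl)) → case ≃⁺⇒inhabited t≃ of λ (a , a∈) →
          ∉∅ (subst (a ∈_) (≃∅⇒≡∅ s≃) (t⊆s a a∈)))
      (λ m m∈ ih s k t k∈ s≃ t≃ t⊆s m∈k → case zero-or-suc k∈ of λ where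
        (inj₁ refl)            → ∉∅ m∈k
        (inj₂ (i , i∈ , refl)) → case ≃⁺⇒inhabited t≃ of λ (a , a∈) →
          ih _ i _ i∈ (≃-∖ s≃ (t⊆s a a∈)) (≃-∖ t≃ a∈) (∖-mono t⊆s) (⁺∈⁺ i∈ m∈k))
      m∈ _ _ _ k∈ s≃ t≃

    ≃-unique : ∀ {s j k} → j ∈ ω → k ∈ ω → s ≃ j → s ≃ k → j ≡ k
    ≃-unique j∈ k∈ s≃j s≃k with compare-ω j∈ k∈
    ... | inj₁ p        = ⊥-elim (≃-monotone j∈ k∈ s≃j s≃k (λ _ → id) p)
    ... | inj₂ (inj₁ p) = p
    ... | inj₂ (inj₂ p) = ⊥-elim (≃-monotone k∈ j∈ s≃k s≃j (λ _ → id) p)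

    ≃-⊆⇒⊇ : ∀ {s t k} → k ∈ ω → s ≃ k → t ≃ k → s ⊆ t → t ⊆ s
    ≃-⊆⇒⊇ {s} k∈ s≃ t≃ s⊆t a a∈t = by-contradiction λ a∉s →
      ≃-monotone k∈ (⁺∈ω k∈) t≃ (≃-⊕ s≃ a∉s)
        (λ z z∈ → [ s⊆t z , (λ { refl → a∈t }) ]′ (to ∈⊕ z∈)) ⊕-new

    ≃⇒finite : ∀ {s k} → k ∈ ω → s ≃ k → IsFinite s
    ≃⇒finite {s} k∈ = ω-induction (∀ᶠ (equinumerous [ 0F ∷ 1F ∷ [] ] ⇒ᶠ fin [ 0F ∷ [] ]))
      (λ s s≃ → subst IsFinite (sym (≃∅⇒≡∅ s≃)) finite-∅)
      (λ k _ ih s s≃ → case ≃⁺⇒inhabited s≃ of λ (a , a∈) →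
        subst IsFinite (sym (∖⊕ a∈)) (finite-⊕ (ih _ (≃-∖ s≃ a∈))))
      k∈ s

    finite⇒≃ : ∀ {s} → IsFinite s → ∃[ k ] (k ∈ ω × s ≃ k)
    finite⇒≃ h = finite-induction (∃ᶠ (v0 ∈ᶠ con ω ∧ᶠ equinumerous [ 1F ∷ 0F ∷ [] ])) h
      (∅ , ∅∈ω , ∅≃∅)
      (λ t a _ a∉t (k , k∈ , t≃) → k ⁺ , ⁺∈ω k∈ , ≃-⊕ t≃ a∉t)

    Finite⇒finite : ∀ {s} → Finite ω s → IsFinite s
    Finite⇒finite (k , k∈ , s≈k) = ≃⇒finite k∈ (≈⇒≃ s≈k)

    finite⇒Finite : ∀ {s} → IsFinite s → Finite ω s
    finite⇒Finite h = case finite⇒≃ h of λ (k , k∈ , s≃) → k , k∈ , ≃⇒≈ s≃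

    -- One point is added per induction step and only existence of `t` is carried, so no infinite
    -- sequence of choices arises.
    infinite⇒subsets : ∀ {s k} → ¬ IsFinite s → k ∈ ω → ∃[ t ] (t ⊆ s × t ≃ k)
    infinite⇒subsets {s} inf = ω-induction (∃ᶠ (v0 ⊆ᶠ con s ∧ᶠ equinumerous [ 0F ∷ 1F ∷ [] ]))
      (∅ , (λ _ → ⊥-elim ∘ ∉∅) , ∅≃∅)
      (λ k k∈ (t , t⊆s , t≃) → case empty-or-inhabited (s ∖ t) of λ where
        (inj₁ e) → ⊥-elim (inf (finite-⊆ (≃⇒finite k∈ t≃) λ z z∈ → by-contradiction λ z∉t →
          ∉∅ (subst (z ∈_) e (from ∈∖ (z∈ , z∉t)))))
        (inj₂ (a , a∈)) → case to ∈∖ a∈ of λ (a∈s , a∉t) →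
          t ⊕ a , (λ z z∈ → [ t⊆s z , (λ { refl → a∈s }) ]′ (to ∈⊕ z∈)) , ≃-⊕ t≃ a∉t)

    related : Fm 2 → V → V → Set ℓ
    related L x y = ⟦ L ⟧ (x ∷ y ∷ [])

    -- A strict linear order with finite initial segments embeds into ω, by
    -- counting predecessors.

    module FiniteSegments (X : V) (L : Fm 2)
      (linear   : ∀ x y → x ∈ X → y ∈ X → related L x y ⊎ x ≡ y ⊎ related L y x)
      (irrefl   : ∀ x → x ∈ X → ¬ related L x x)
      (transit  : ∀ x y z → x ∈ X → y ∈ X → z ∈ X → related L x y → related L y z → related L x z)
      (segments : ∀ y → y ∈ X → ∃[ t ] (IsFinite t × (∀ x → x ∈ X → related L x y → x ∈ t)))
      where

      _◁_ : V → V → Set ℓ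
      _◁_ = related L

      private
        below : V → Fm 1
        below y = letᶠ (con y) (L [ 1F ∷ 0F ∷ [] ])

        segment : V → V
        segment y = sep X (below y)

        -- `segment y` is formed by separation and is not a term of the formula language, so the
        -- formula speaks of a set having exactly its elements. `is-deletion`, `is-column` and
        -- `is-row` describe their sets in the same way.
        position : Fm 2
        position = ∃ᶠ (equinumerous [ 0F ∷ 2F ∷ [] ] ∧ᶠ
          ∀ᶠ ((v0 ∈ᶠ v1 ⇒ᶠ v0 ∈ᶠ con X ∧ᶠ L [ 0F ∷ 2F ∷ [] ]) ∧ᶠ
              (v0 ∈ᶠ con X ∧ᶠ L [ 0F ∷ 2F ∷ [] ] ⇒ᶠ v0 ∈ᶠ v1)))

        segment≃ : ∀ {y k} → ⟦ position ⟧ (y ∷ k ∷ []) → segment y ≃ k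
        segment≃ {y} {k} (s , s≃ , h) = subst (_≃ k)
          (ext (λ z z∈ → from (∈sep (below y)) (proj₁ (h z) z∈))
               (λ z z∈ → proj₂ (h z) (to (∈sep (below y)) z∈))) s≃

        ≃segment : ∀ {y k} → segment y ≃ k → ⟦ position ⟧ (y ∷ k ∷ [])
        ≃segment {y} s≃ = segment y , s≃ , λ z → to (∈sep (below y)) , from (∈sep (below y))

        segment-finite : ∀ {y} → y ∈ X → IsFinite (segment y)
        segment-finite {y} y∈ = case segments y y∈ of λ (t , ft , h) →
          finite-⊆ ft λ z z∈ → case to (∈sep (below y)) z∈ of λ (z∈X , z◁y) → h z z∈X z◁y

        total : ∀ y → y ∈ X → ∃[ k ] (k ∈ ω × ⟦ position ⟧ (y ∷ k ∷ []))
        total y y∈ = case finite⇒≃ (segment-finite y∈) of λ (k , k∈ , s≃) → k , k∈ , ≃segment s≃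

        functional : ∀ x k k′ → x ∈ X → k ∈ ω → k′ ∈ ω →
          ⟦ position ⟧ (x ∷ k ∷ []) → ⟦ position ⟧ (x ∷ k′ ∷ []) → k ≡ k′
        functional x k k′ _ k∈ k′∈ p q = ≃-unique k∈ k′∈ (segment≃ p) (segment≃ q)

        -- If `x ◁ y`, the segment of `x` lies in that of `y`; being of the same finite size they
        -- coincide, and `x` would precede itself.
        distinct : ∀ x y k → x ∈ X → y ∈ X → k ∈ ω →
          ⟦ position ⟧ (x ∷ k ∷ []) → ⟦ position ⟧ (y ∷ k ∷ []) → ¬ x ◁ y
        distinct x y k x∈ y∈ k∈ p q x◁y = irrefl x x∈ (proj₂ (to (∈sep (below x))
          (≃-⊆⇒⊇ k∈ (segment≃ p) (segment≃ q)
            (λ z z∈ → case to (∈sep (below x)) z∈ of λ (z∈X , z◁x) →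
              from (∈sep (below y)) (z∈X , transit z x y z∈X x∈ y∈ z◁x x◁y))
            x (from (∈sep (below y)) (x∈ , x◁y)))))

        injective : ∀ x y k → x ∈ X → y ∈ X → k ∈ ω →
          ⟦ position ⟧ (x ∷ k ∷ []) → ⟦ position ⟧ (y ∷ k ∷ []) → x ≡ y
        injective x y k x∈ y∈ k∈ p q with linear x y x∈ y∈
        ... | inj₁ h        = ⊥-elim (distinct x y k x∈ y∈ k∈ p q h)
        ... | inj₂ (inj₁ h) = h
        ... | inj₂ (inj₂ h) = ⊥-elim (distinct y x k y∈ x∈ k∈ q p h)

      countable : Countable ω X
      countable = _ , graph-injection position total functional injective

      -- Every position is taken: the element after `y` is the minimum of what lies outside
      -- `segment y ⊕ y`, and this remainder is inhabited because `X` is infinite.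
      infinite⇒≈ω : ¬ IsFinite X →
        (∀ U → U ⊆ X → ∃[ x ] x ∈ U → ∃[ m ] (m ∈ U × (∀ x → x ∈ U → ¬ x ◁ m))) → X ≈ ω
      infinite⇒≈ω inf minimum =
        _ , graph-injection position total functional injective
          , graph-surjection position total functional λ k → ω-induction
              (∃ᶠ (v0 ∈ᶠ con X ∧ᶠ position [ 0F ∷ 1F ∷ [] ])) base step
        where
          base : ∃[ y ] (y ∈ X × ⟦ position ⟧ (y ∷ ∅ ∷ []))
          base with empty-or-inhabited X
          ... | inj₁ refl = ⊥-elim (inf finite-∅)
          ... | inj₂ x with minimum X (λ _ → id) x
          ... | m , m∈ , h = m , m∈ , ≃segment (subst (_≃ ∅) (sym (ext
                  (λ z z∈ → case to (∈sep (below m)) z∈ of λ (z∈X , z◁m) → ⊥-elim (h z z∈X z◁m))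
                  (λ _ → ⊥-elim ∘ ∉∅))) ∅≃∅)
          step : ∀ k → k ∈ ω → ∃[ y ] (y ∈ X × ⟦ position ⟧ (y ∷ k ∷ [])) →
                 ∃[ y ] (y ∈ X × ⟦ position ⟧ (y ∷ k ⁺ ∷ []))
          step k k∈ (y , y∈ , p) with empty-or-inhabited (X ∖ (segment y ⊕ y))
          ... | inj₁ e = ⊥-elim (inf (finite-⊆ (finite-⊕ (segment-finite y∈)) λ z z∈ →
                  by-contradiction λ z∉ → ∉∅ (subst (z ∈_) e (from ∈∖ (z∈ , z∉)))))
          ... | inj₂ x with minimum _ (λ z → proj₁ ∘ to ∈∖) x
          ... | m , m∈ , h with to ∈∖ m∈
          ... | m∈X , m∉ = m , m∈X , ≃segment (subst (_≃ k ⁺)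
                  (ext (λ z z∈ → from (∈sep (below m)) (before z (to ∈⊕ z∈)))
                       (λ z z∈ → case to (∈sep (below m)) z∈ of λ (z∈X , z◁m) →
                          by-contradiction λ z∉ → h z (from ∈∖ (z∈X , z∉)) z◁m))
                  (≃-⊕ (segment≃ p) (λ y∈s → irrefl y y∈ (proj₂ (to (∈sep (below y)) y∈s)))))
            where
              y◁m : y ◁ m
              y◁m with linear y m y∈ m∈X
              ... | inj₁ q           = q
              ... | inj₂ (inj₁ refl) = ⊥-elim (m∉ ⊕-new)
              ... | inj₂ (inj₂ q)    = ⊥-elim (m∉ (⊕-old (from (∈sep (below y)) (m∈X , q))))
              before : ∀ z → z ∈ segment y ⊎ z ≡ y → z ∈ X × z ◁ m
              before z (inj₂ refl) = y∈ , y◁m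
              before z (inj₁ z∈) = case to (∈sep (below y)) z∈ of λ (z∈X , z◁y) →
                z∈X , transit z y m z∈X y∈ m∈X z◁y y◁m

    strict-upper-bound : ∀ {i j} → i ∈ ω → j ∈ ω → ∃[ m ] (m ∈ ω × i ∈ m × j ∈ m)
    strict-upper-bound {i} {j} i∈ j∈ with compare-ω i∈ j∈
    ... | inj₁ p           = j ⁺ , ⁺∈ω j∈ , ⊕-old p , ⊕-new
    ... | inj₂ (inj₁ refl) = j ⁺ , ⁺∈ω j∈ , ⊕-new , ⊕-new
    ... | inj₂ (inj₂ p)    = i ⁺ , ⁺∈ω i∈ , ⊕-new , ⊕-old p

    -- The elements of ω₁ are ordered first by the least index of a piece that
    -- contains them, then by ∈.

    ω₁-not-covered : ∀ (F : Fm 2) →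
      (∀ m → m ∈ ω → ∃[ t ] (IsFinite t × (∀ x → x ∈ ω₁ → ⟦ F ⟧ (m ∷ x ∷ []) → x ∈ t))) →
      (∀ x → x ∈ ω₁ → ∃[ m ] (m ∈ ω × ⟦ F ⟧ (m ∷ x ∷ []))) → ⊥
    ω₁-not-covered F finite cover =
      proj₁ (proj₂ isω₁) (FiniteSegments.countable ω₁ L linear irrefl transit segments)
      where
        rank : Fm 2
        rank = v1 ∈ᶠ con ω ∧ᶠ F [ 1F ∷ 0F ∷ [] ] ∧ᶠ (∀ᶠ (v0 ∈ᶠ con ω ⇒ᶠ F [ 0F ∷ 1F ∷ [] ] ⇒ᶠ ¬ᶠ v0 ∈ᶠ v2))
        L : Fm 2
        L = ∃ᶠ ∃ᶠ (rank [ 2F ∷ 1F ∷ [] ] ∧ᶠ rank [ 3F ∷ 0F ∷ [] ] ∧ᶠ (v1 ∈ᶠ v0 ∨ᶠ v1 ≡ᶠ v0 ∧ᶠ v2 ∈ᶠ v3))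
        ranked : ∀ x → x ∈ ω₁ → ∃[ m ] ⟦ rank ⟧ (x ∷ m ∷ [])
        ranked x x∈ = least-ω (letᶠ (con x) (F [ 1F ∷ 0F ∷ [] ])) (cover x x∈)
        rank-unique : ∀ {x m k} → ⟦ rank ⟧ (x ∷ m ∷ []) → ⟦ rank ⟧ (x ∷ k ∷ []) → m ≡ k
        rank-unique {x} {m} {k} (m∈ , p , h) (k∈ , q , h′) with compare-ω m∈ k∈
        ... | inj₁ r        = ⊥-elim (h′ m m∈ p r)
        ... | inj₂ (inj₁ r) = r
        ... | inj₂ (inj₂ r) = ⊥-elim (h k k∈ q r)
        linear : ∀ x y → x ∈ ω₁ → y ∈ ω₁ →
                 ⟦ L ⟧ (x ∷ y ∷ []) ⊎ x ≡ y ⊎ ⟦ L ⟧ (y ∷ x ∷ [])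
        linear x y x∈ y∈ with ranked x x∈ | ranked y y∈
        ... | m , p | k , q with compare-ω (proj₁ p) (proj₁ q)
        ... | inj₁ r        = inj₁ (m , k , p , q , inj₁ r)
        ... | inj₂ (inj₂ r) = inj₂ (inj₂ (k , m , q , p , inj₁ r))
        ... | inj₂ (inj₁ r) with compare x∈ y∈
        ... | inj₁ s        = inj₁ (m , k , p , q , inj₂ (r , s))
        ... | inj₂ (inj₁ s) = inj₂ (inj₁ s)
        ... | inj₂ (inj₂ s) = inj₂ (inj₂ (k , m , q , p , inj₂ (sym r , s)))
        irrefl : ∀ x → x ∈ ω₁ → ¬ ⟦ L ⟧ (x ∷ x ∷ [])
        irrefl x _ (m , k , p , q , inj₁ r) = ∈-irrefl (subst (_∈ k) (rank-unique p q) r)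
        irrefl x _ (m , k , p , q , inj₂ (_ , s)) = ∈-irrefl s
        transit : ∀ x y z → x ∈ ω₁ → y ∈ ω₁ → z ∈ ω₁ →
                  ⟦ L ⟧ (x ∷ y ∷ []) → ⟦ L ⟧ (y ∷ z ∷ []) → ⟦ L ⟧ (x ∷ z ∷ [])
        transit x y z _ _ z∈ (m , k , p , q , r) (k′ , j , q′ , s , t) with rank-unique q q′
        ... | refl = m , j , p , s , (case r , t of λ where
          (inj₁ m∈k , inj₁ k∈j)                  → inj₁ (∈-trans (ω⊆ω₁ _ (proj₁ s)) m∈k k∈j)
          (inj₁ m∈k , inj₂ (refl , _))           → inj₁ m∈k
          (inj₂ (refl , _) , inj₁ k∈j)           → inj₁ k∈j
          (inj₂ (refl , x∈y) , inj₂ (refl , y∈z)) → inj₂ (refl , ∈-trans z∈ x∈y y∈z))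
        segments : ∀ y → y ∈ ω₁ →
          ∃[ t ] (IsFinite t × (∀ x → x ∈ ω₁ → ⟦ L ⟧ (x ∷ y ∷ []) → x ∈ t))
        segments y y∈ with ranked y y∈
        -- The successor of the rank `k` is used because elements of rank `k` itself may precede
        -- `y`.
        ... | k , q with finite-⋃ (v1 ∈ᶠ con ω₁ ∧ᶠ F) (finite-∈ω (⁺∈ω (proj₁ q)))
                          (λ m m∈ → case finite m (ω-transitive (⁺∈ω (proj₁ q)) m∈) of λ
                            (t , ft , h) → t , ft , λ x (x∈ , p) → h x x∈ p)
        ... | t , ft , h = t , ft , λ where
          x x∈ (m , k′ , p , q′ , r) → case rank-unique q q′ of λ { refl →
            h m ([ ⊕-old , (λ { (refl , _) → ⊕-new }) ]′ r) x (x∈ , proj₁ (proj₂ p)) }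

    -- Triples are not coded. Piece `m` collects the finitely many triples with entries in `m`, and
    -- every triple is below some such bound.
    ω₁-not-covered₃ : ∀ (F : Fm 4) →
      (∀ i j k → i ∈ ω → j ∈ ω → k ∈ ω →
        ∃[ t ] (IsFinite t × (∀ x → x ∈ ω₁ → ⟦ F ⟧ (i ∷ j ∷ k ∷ x ∷ []) → x ∈ t))) →
      (∀ x → x ∈ ω₁ → ∃[ i ] ∃[ j ] ∃[ k ]
        (i ∈ ω × j ∈ ω × k ∈ ω × ⟦ F ⟧ (i ∷ j ∷ k ∷ x ∷ []))) → ⊥
    ω₁-not-covered₃ F finite cover = ω₁-not-covered
      (∃ᶠ ∃ᶠ ∃ᶠ (v2 ∈ᶠ v3 ∧ᶠ v1 ∈ᶠ v3 ∧ᶠ v0 ∈ᶠ v3 ∧ᶠ F [ 2F ∷ 1F ∷ 0F ∷ 4F ∷ [] ]))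
      (λ m m∈ →
        case finite-⋃ (v1 ∈ᶠ con ω₁ ∧ᶠ ∃ᶠ ∃ᶠ (v1 ∈ᶠ con m ∧ᶠ v0 ∈ᶠ con m ∧ᶠ F [ 2F ∷ 1F ∷ 0F ∷ 3F ∷ [] ]))
          (finite-∈ω m∈) (λ i i∈ →
        case finite-⋃ (v1 ∈ᶠ con ω₁ ∧ᶠ letᶠ (con i) (∃ᶠ (v0 ∈ᶠ con m ∧ᶠ F [ 1F ∷ 2F ∷ 0F ∷ 3F ∷ [] ])))
          (finite-∈ω m∈) (λ j j∈ →
        case finite-⋃ (v1 ∈ᶠ con ω₁ ∧ᶠ letᶠ (con i) (letᶠ (con j) (F [ 1F ∷ 0F ∷ 2F ∷ 3F ∷ [] ])))
          (finite-∈ω m∈) (λ k k∈ →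
        case finite i j k (ω-transitive m∈ i∈) (ω-transitive m∈ j∈) (ω-transitive m∈ k∈) of λ
          (t , ft , h) → t , ft , λ x (x∈ , p) → h x x∈ p) of λ
          (t , ft , h) → t , ft , λ { x (x∈ , k , k∈ , p) → h k k∈ x (x∈ , p) }) of λ
          (t , ft , h) → t , ft , λ { x (x∈ , j , k , j∈ , k∈ , p) → h j j∈ x (x∈ , k , k∈ , p) }) of λ
          (t , ft , h) → t , ft , λ { x x∈ (i , j , k , i∈ , j∈ , k∈ , p) →
            h i i∈ x (x∈ , j , k , j∈ , k∈ , p) })
      (λ x x∈ → case cover x x∈ of λ (i , j , k , i∈ , j∈ , k∈ , p) →
        case strict-upper-bound i∈ j∈ of λ (m , m∈ , i∈m , j∈m) →
        case strict-upper-bound m∈ k∈ of λ (n , n∈ , m∈n , k∈n) →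
          n , n∈ , i , j , k , ∈-trans (ω⊆ω₁ n n∈) i∈m m∈n , ∈-trans (ω⊆ω₁ n n∈) j∈m m∈n , k∈n , p)

    -- `ω` is a chain that covers itself, each `x` lying in `x ⁺`; were it finite, it would be
    -- contained in one of its own elements.
    ω-infinite : ¬ IsFinite ω
    ω-infinite h = case finite-⊆-chain chain (∅ , ∅∈ω) h (λ x x∈ → x ⁺ , ⁺∈ω x∈ , ⊕-new) of λ
      (c , c∈ , ω⊆c) → ∈-irrefl (ω⊆c c c∈)
      where
        chain : Chain ω
        chain j k j∈ k∈ with em {j ∈ k}
        ... | yes p = inj₁ λ z z∈ → ∈-trans (ω⊆ω₁ k k∈) z∈ p
        ... | no p  = inj₂ (∉⇒⊆ (ω⊆ω₁ j j∈) (ω⊆ω₁ k k∈) p)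

    ≈ω⇒infinite : ∀ {s} → s ≈ ω → ¬ IsFinite s
    ≈ω⇒infinite {s} (f , ((F , _) , _) , (_ , sur)) h =
      case finite-⋃ (⟨ v0 , v1 ⟩ᵗ ∈ᶠ con f) h
             (λ x _ → subsingleton-finite _ λ y y′ → value-unique F) of λ
        (t , ft , p) → ω-infinite (finite-⊆ ft λ k k∈ → case sur k k∈ of λ
          (x , q) → p x (argument F q) k q)

    -- The order of `ω` pulled back along `e` has finite initial segments and minima, so
    -- `FiniteSegments` applies.
    infinite⊆countable⇒≈ω : ∀ {X Y} → Countable ω Y → X ⊆ Y → ¬ IsFinite X → X ≈ ω
    infinite⊆countable⇒≈ω {X} {Y} (e , (E , e∈) , e-inj) X⊆Y inf =
      FiniteSegments.infinite⇒≈ω X L linear irrefl transit segments inf minimum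
      where
        L : Fm 2
        L = ∃ᶠ ∃ᶠ (⟨ v2 , v1 ⟩ᵗ ∈ᶠ con e ∧ᶠ ⟨ v3 , v0 ⟩ᵗ ∈ᶠ con e ∧ᶠ v1 ∈ᶠ v0)
        linear : ∀ x y → x ∈ X → y ∈ X → ⟦ L ⟧ (x ∷ y ∷ []) ⊎ x ≡ y ⊎ ⟦ L ⟧ (y ∷ x ∷ [])
        linear x y x∈ y∈ with value E (X⊆Y x x∈) | value E (X⊆Y y y∈)
        ... | m , p | k , q with compare-ω (e∈ _ _ p) (e∈ _ _ q)
        ... | inj₁ r           = inj₁ (m , k , p , q , r)
        ... | inj₂ (inj₁ refl) = inj₂ (inj₁ (e-inj _ _ _ p q))
        ... | inj₂ (inj₂ r)    = inj₂ (inj₂ (k , m , q , p , r))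
        irrefl : ∀ x → x ∈ X → ¬ ⟦ L ⟧ (x ∷ x ∷ [])
        irrefl x _ (m , k , p , q , r) = ∈-irrefl (subst (_∈ k) (value-unique E p q) r)
        transit : ∀ x y z → x ∈ X → y ∈ X → z ∈ X →
                  ⟦ L ⟧ (x ∷ y ∷ []) → ⟦ L ⟧ (y ∷ z ∷ []) → ⟦ L ⟧ (x ∷ z ∷ [])
        transit x y z _ _ _ (m , k , p , q , r) (k′ , j , q′ , s , t) with value-unique E q q′
        ... | refl = m , j , p , s , ∈-trans (ω⊆ω₁ j (e∈ _ _ s)) r t
        segments : ∀ y → y ∈ X →
          ∃[ t ] (IsFinite t × (∀ x → x ∈ X → ⟦ L ⟧ (x ∷ y ∷ []) → x ∈ t))
        segments y y∈ with value E (X⊆Y y y∈)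
        ... | k , q with finite-⋃ (⟨ v1 , v0 ⟩ᵗ ∈ᶠ con e) (finite-∈ω (e∈ _ _ q))
                          (λ m _ → subsingleton-finite _ λ x x′ → e-inj x x′ m)
        ... | t , ft , h = t , ft , λ x _ (m , k′ , p , q′ , r) →
                h m (subst (m ∈_) (value-unique E q′ q) r) x p
        minimum : ∀ U → U ⊆ X → ∃[ x ] x ∈ U → ∃[ m ] (m ∈ U × (∀ x → x ∈ U → ¬ ⟦ L ⟧ (x ∷ m ∷ [])))
        minimum U U⊆X (x , x∈) with value E (X⊆Y x (U⊆X x x∈))
        ... | k , p with least-ω (∃ᶠ (v0 ∈ᶠ con U ∧ᶠ ⟨ v0 , v1 ⟩ᵗ ∈ᶠ con e)) (k , e∈ _ _ p , x , x∈ , p)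
        ... | m , m∈ , (u , u∈ , q) , min = u , u∈ , λ y y∈ (j , i , r , s , t) →
                min j (e∈ _ _ r) (y , y∈ , r) (subst (j ∈_) (value-unique E s q) t)

  -- Part (1): essential disjointness from a uniform denumeration.

  module UniformlyDenumerated {ω ω₁ : V} (isω : IsOmega ω) (isω₁ : IsOmega₁ ω ω₁) (ud : UD ω ω₁) where

    open OmegaOne isω isω₁
    open Counting isω isω₁

    private
      u : V
      u = proj₁ ud

      u-function : FunctionOn u ω₁
      u-function = proj₁ (proj₂ ud)

    -- enumerates α i x: x ∈ α is the value at i of the given enumeration of α.

    opaque
      enumerates : Fm 3
      enumerates = v2 ∈ᶠ v0 ∧ᶠ v1 ∈ᶠ con ω ∧ᶠ ∃ᶠ (⟨ v1 , v0 ⟩ᵗ ∈ᶠ con u ∧ᶠ ⟨ v2 , v3 ⟩ᵗ ∈ᶠ v0)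

    Enumerates : V → V → V → Set ℓ
    Enumerates α i x = ⟦ enumerates ⟧ (α ∷ i ∷ x ∷ [])

    opaque
      unfolding enumerates

      -- The point `x` rules out `α = ∅`, where the denumeration promises nothing.
      enumeration : ∀ {α g x} → α ∈ ω₁ → x ∈ α → ⟨ α , g ⟩ ∈ u → g ∶ ω ↠ α
      enumeration {α} {g} {x} α∈ x∈ h = proj₂ (proj₂ ud) α g 𝟏≤α α∈ h
        where
          𝟏≤α : 𝟏 ≤ α
          𝟏≤α with compare (⁺∈ω₁ ∅∈ω₁) α∈
          ... | inj₁ p        = inj₁ p
          ... | inj₂ (inj₁ p) = inj₂ p
          ... | inj₂ (inj₂ p) with to ∈⊕ p
          ... | inj₁ q    = ⊥-elim (∉∅ q)
          ... | inj₂ refl = ⊥-elim (∉∅ x∈)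

      enumerates-exists : ∀ {α x} → α ∈ ω₁ → x ∈ α → ∃[ i ] (i ∈ ω × Enumerates α i x)
      enumerates-exists {α} {x} α∈ x∈ =
        case value u-function α∈ of λ (g , h) →
        case enumeration α∈ x∈ h of λ ((g-function , _) , sur) →
        case sur x x∈ of λ (i , q) →
          i , argument g-function q , x∈ , argument g-function q , g , h , q

      enumerates-unique : ∀ {α i x y} → Enumerates α i x → Enumerates α i y → x ≡ y
      enumerates-unique (x∈ , _ , g , h , p) (_ , _ , g′ , h′ , q) =
        case value-unique u-function h h′ of λ where
          refl → value-unique (proj₁ (proj₁ (enumeration (argument u-function h) x∈ h))) p q

    ⊆⇒∈⁺ : ∀ {x β} → x ∈ ω₁ → β ∈ ω₁ → x ⊆ β → x ∈ β ⁺
    ⊆⇒∈⁺ {x} {β} x∈ β∈ x⊆β with compare x∈ β∈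
    ... | inj₁ p           = ⊕-old p
    ... | inj₂ (inj₁ refl) = ⊕-new
    ... | inj₂ (inj₂ p)    = ⊥-elim (∈-irrefl (x⊆β β p))

    -- Regularity of `ω₁`. If `T` were unbounded, every point would lie in some `t ∈ T` and be found
    -- from an index of `t` and a place in the enumeration of `t`, which covers `ω₁` by finite
    -- pieces. Finite fibres are allowed because the sets bounded later come with an index into `ω`
    -- that need not be injective.
    countable⇒bounded : ∀ (ψ : Fm 2) {T} → T ⊆ ω₁ →
      (∀ t → t ∈ T → ∃[ m ] (m ∈ ω × ⟦ ψ ⟧ (m ∷ t ∷ []))) →
      (∀ m → m ∈ ω → ∃[ s ] (IsFinite s × (∀ t → t ∈ T → ⟦ ψ ⟧ (m ∷ t ∷ []) → t ∈ s))) →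
      ∃[ β ] (β ∈ ω₁ × T ⊆ β)
    countable⇒bounded ψ {T} T⊆ω₁ index fibres = by-contradiction λ unbounded →
      ω₁-not-covered₃
        (∃ᶠ (v0 ∈ᶠ con T ∧ᶠ ψ [ 1F ∷ 0F ∷ [] ] ∧ᶠ enumerates [ 0F ∷ 2F ∷ 4F ∷ [] ]))
        (λ i j k i∈ _ _ → case fibres i i∈ of λ (s , fs , p) →
          case finite-⋃ (letᶠ (con j) (enumerates [ 1F ∷ 0F ∷ 2F ∷ [] ])) fs
                 (λ t _ → subsingleton-finite _ λ x y → enumerates-unique) of λ
            (r , fr , q) → r , fr , λ x _ (t , t∈ , h , e) → q t (p t t∈ h) x e)
        (λ x x∈ → case em {∃[ t ] (t ∈ T × x ∈ t)} of λ where
          (yes (t , t∈ , x∈t)) →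
            case index t t∈ of λ (i , i∈ , h) →
            case enumerates-exists (T⊆ω₁ t t∈) x∈t of λ (j , j∈ , e) →
              -- Only `i` and `j` carry information; `∅` fills the third index.
              i , j , ∅ , i∈ , j∈ , ∅∈ω , t , t∈ , h , e
          -- A point `x` in no member of `T` has all of `T` at or below it.
          (no ¬∃) → ⊥-elim (unbounded (x ⁺ , ⁺∈ω₁ x∈ , λ t t∈ →
            ⊆⇒∈⁺ (T⊆ω₁ t t∈) x∈ (∉⇒⊆ x∈ (T⊆ω₁ t t∈) λ x∈t → ¬∃ (t , t∈ , x∈t)))))

    ordinals-chain : ∀ {𝒞} → 𝒞 ⊆ ω₁ → Chain 𝒞
    ordinals-chain 𝒞⊆ c c′ c∈ c′∈ with em {c ∈ c′}
    ... | yes p = inj₁ λ z z∈ → ∈-trans (𝒞⊆ c′ c′∈) z∈ p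
    ... | no p  = inj₂ (∉⇒⊆ (𝒞⊆ c c∈) (𝒞⊆ c′ c′∈) p)

    module Family {n 𝒜 : V} (n∈ : n ∈ ω) (members : ∀ A → A ∈ 𝒜 → A ⊆ ω₁ × A ≈ ω)
                  (almost-disjoint : AlmostDisjoint n 𝒜) where

      opaque
        -- The size `n ⁺` keeps witnesses nonempty even for `n = ∅`; `big-chain` draws from such a
        -- point a first member of the chain.
        big : Fm 1
        big = ∃ᶠ (v0 ⊆ᶠ v1 ∧ᶠ letᶠ (con (n ⁺)) (equinumerous [ 1F ∷ 0F ∷ [] ]))

      Big : V → Set ℓ
      Big s = ⟦ big ⟧ (s ∷ [])

      opaque
        unfolding big

        big-witness : ∀ {s} → Big s → ∃[ t ] (t ⊆ s × t ≃ n ⁺)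
        big-witness = id

        ≃⇒big : ∀ {s t} → t ⊆ s → t ≃ n ⁺ → Big s
        ≃⇒big {t = t} p q = t , p , q

      big-monotone : ∀ {s t} → s ⊆ t → Big s → Big t
      big-monotone s⊆t b = case big-witness b of λ (r , p , q) → ≃⇒big (λ z → s⊆t z ∘ p z) q

      infinite⇒big : ∀ {s} → ¬ IsFinite s → Big s
      infinite⇒big inf = case infinite⇒subsets inf (⁺∈ω n∈) of λ (t , p , q) → ≃⇒big p q

      small⇒finite : ∀ {s} → ¬ Big s → IsFinite s
      small⇒finite h = by-contradiction (h ∘ infinite⇒big)

      big-chain : ∀ {𝒞 s} → Chain 𝒞 → Big s → (∀ x → x ∈ s → ∃[ c ] (c ∈ 𝒞 × x ∈ c)) →
                  ∃[ c ] (c ∈ 𝒞 × Big (s ∩ c))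
      big-chain {𝒞} {s} chain b cover =
        case big-witness b of λ (t , t⊆s , t≃) →
        case ≃⁺⇒inhabited t≃ of λ (a , a∈) →
        case cover a (t⊆s a a∈) of λ (c₀ , c₀∈ , _) →
        case finite-⊆-chain chain (c₀ , c₀∈) (≃⇒finite (⁺∈ω n∈) t≃) (λ x x∈ → cover x (t⊆s x x∈)) of λ
          (c , c∈ , t⊆c) → c , c∈ , ≃⇒big (λ x x∈ → from ∈∩ (t⊆s x x∈ , t⊆c x x∈)) t≃

      intersection-small : ∀ {A B} → A ∈ 𝒜 → B ∈ 𝒜 → A ≢ B → ¬ Big (A ∩ B)
      intersection-small {A} {B} A∈ B∈ A≢B b =
        case almost-disjoint A B A∈ B∈ A≢B of λ (m , m∈n , A∩B≈m) →
        case big-witness b of λ (t , t⊆ , t≃) →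
          ≃-monotone (ω-transitive n∈ m∈n) (⁺∈ω n∈) (≈⇒≃ A∩B≈m) t≃ t⊆ (⊕-old m∈n)

      big-trace-unique : ∀ {A B s} → A ∈ 𝒜 → B ∈ 𝒜 → Big s → s ⊆ A → s ⊆ B → A ≡ B
      big-trace-unique A∈ B∈ b p q = by-contradiction λ A≢B →
        intersection-small A∈ B∈ A≢B (big-monotone (λ z z∈ → from ∈∩ (p z z∈ , q z z∈)) b)

      member-big : ∀ {A} → A ∈ 𝒜 → Big A
      member-big A∈ = infinite⇒big (≈ω⇒infinite (proj₂ (members _ A∈)))

      -- A finite set has finitely many subsets, and each big one lies in at most one member, so a
      -- member is determined by its trace.
      finitely-many-big-traces : ∀ {s} → IsFinite s →
        ∃[ T ] (IsFinite T × (∀ A → A ∈ 𝒜 → Big (A ∩ s) → A ∈ T))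
      finitely-many-big-traces {s} fs =
        case finite-𝒫 fs of λ (P , fP , p) →
        case finite-⋃ (v1 ∈ᶠ con 𝒜 ∧ᶠ v0 ⊆ᶠ v1 ∧ᶠ big [ 0F ∷ [] ]) fP
               (λ r _ → subsingleton-finite _ λ A B (A∈ , r⊆A , b) (B∈ , r⊆B , _) →
                 big-trace-unique A∈ B∈ b r⊆A r⊆B) of λ
          (T , fT , q) → T , fT , λ A A∈ b →
            q (A ∩ s) (p _ λ z z∈ → proj₂ (to ∈∩ z∈)) A (A∈ , (λ z z∈ → proj₁ (to ∈∩ z∈)) , b)

      -- reaches α m A: more than n elements of A ∩ α are enumerated before m.

      opaque
        reaches : Fm 3
        reaches = ∃ᶠ (v0 ⊆ᶠ v3 ∧ᶠ big [ 0F ∷ [] ]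
          ∧ᶠ (∀ᶠ (v0 ∈ᶠ v1 ⇒ᶠ ∃ᶠ (v0 ∈ᶠ v4 ∧ᶠ enumerates [ 3F ∷ 0F ∷ 1F ∷ [] ]))))

      Reaches : V → V → V → Set ℓ
      Reaches α m A = ⟦ reaches ⟧ (α ∷ m ∷ A ∷ [])

      opaque
        unfolding reaches

        reaches-monotone : ∀ {α m k A} → m ⊆ k → Reaches α m A → Reaches α k A
        reaches-monotone m⊆k (t , t⊆A , b , e) =
          t , t⊆A , b , λ x x∈ → case e x x∈ of λ (i , i∈ , h) → i , m⊆k i i∈ , h

        -- Finitely many points are enumerated before `m`, and a member reached by then has a big
        -- trace on them. This sorts the members with big trace on `α` into finite classes.
        finitely-many-reach : ∀ α {m} → m ∈ ω →
          ∃[ T ] (IsFinite T × (∀ A → A ∈ 𝒜 → Reaches α m A → A ∈ T))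
        finitely-many-reach α {m} m∈ =
          case finite-⋃ (letᶠ (con α) (enumerates [ 0F ∷ 1F ∷ 2F ∷ [] ])) (finite-∈ω m∈)
                 (λ i _ → subsingleton-finite _ λ x y → enumerates-unique) of λ
            (s , fs , p) → case finitely-many-big-traces fs of λ
            (T , fT , q) → T , fT , λ A A∈ (t , t⊆A , b , e) → q A A∈
              (big-monotone (λ x x∈ → from ∈∩ (t⊆A x x∈ ,
                (case e x x∈ of λ (i , i∈ , h) → p i i∈ x h))) b)

        -- The witness of bigness is finite, so the induction finds a common bound for places of its
        -- points in the enumeration.
        big⇒reaches : ∀ {α A} → α ∈ ω₁ → Big (A ∩ α) → ∃[ m ] (m ∈ ω × Reaches α m A)
        big⇒reaches {α} {A} α∈ b =
          case big-witness b of λ (t , t⊆ , t≃) →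
          case finite-induction
            ((∀ᶠ (v0 ∈ᶠ v1 ⇒ᶠ ∃ᶠ (v0 ∈ᶠ con ω ∧ᶠ letᶠ (con α) (enumerates [ 0F ∷ 1F ∷ 2F ∷ [] ])))) ⇒ᶠ
             ∃ᶠ (v0 ∈ᶠ con ω ∧ᶠ (∀ᶠ (v0 ∈ᶠ v2 ⇒ᶠ
               ∃ᶠ (v0 ∈ᶠ v2 ∧ᶠ letᶠ (con α) (enumerates [ 0F ∷ 1F ∷ 2F ∷ [] ]))))))
            (≃⇒finite (⁺∈ω n∈) t≃)
            (λ _ → ∅ , ∅∈ω , λ _ → ⊥-elim ∘ ∉∅)
            (λ s a _ _ ih each →
              case ih (λ x x∈ → each x (⊕-old x∈)) of λ (m , m∈ , p) →
              case each a ⊕-new of λ (i , i∈ , e) →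
              case strict-upper-bound m∈ i∈ of λ (k , k∈ , m∈k , i∈k) →
                k , k∈ , λ x x∈ → case to ∈⊕ x∈ of λ where
                  (inj₁ x∈s)  → case p x x∈s of λ (j , j∈ , h) → j , ∈-trans (ω⊆ω₁ k k∈) j∈ m∈k , h
                  (inj₂ refl) → i , i∈k , e)
            (λ x x∈ → enumerates-exists α∈ (proj₂ (to ∈∩ (t⊆ x x∈)))) of λ
            (m , m∈ , p) → m , m∈ , t , (λ x x∈ → proj₁ (to ∈∩ (t⊆ x x∈))) , ≃⇒big (λ _ → id) t≃ , p

      member-bounded : ∀ {A} → A ∈ 𝒜 → ∃[ β ] (β ∈ ω₁ × A ⊆ β)
      member-bounded {A} A∈ =
        case members A A∈ of λ (A⊆ω₁ , f , ((f-function , f∈ω) , f-inj) , _) →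
          countable⇒bounded (⟨ v1 , v0 ⟩ᵗ ∈ᶠ con f) A⊆ω₁
            (λ t t∈ → case value f-function t∈ of λ (m , h) → m , f∈ω _ _ h , h)
            (λ m _ → case subsingleton-finite (λ t → ⟨ t , m ⟩ ∈ f) (λ x y → f-inj x y m) of λ
              (s , fs , p) → s , fs , λ t _ → p t)

      opaque
        -- Replaces a member by a canonical ordinal, so that regularity can be applied to a set of
        -- members.
        strict-supremum : Fm 2
        strict-supremum = v1 ∈ᶠ con ω₁ ∧ᶠ v0 ⊆ᶠ v1 ∧ᶠ (∀ᶠ (v0 ∈ᶠ con ω₁ ⇒ᶠ v1 ⊆ᶠ v0 ⇒ᶠ ¬ᶠ v0 ∈ᶠ v2))

      StrictSupremum : V → V → Set ℓ
      StrictSupremum A β = ⟦ strict-supremum ⟧ (A ∷ β ∷ [])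

      opaque
        unfolding strict-supremum

        strict-supremum-exists : ∀ {A} → A ∈ 𝒜 → ∃[ β ] (β ∈ ω₁ × A ⊆ β × StrictSupremum A β)
        strict-supremum-exists {A} A∈ = case least (con A ⊆ᶠ v0) (member-bounded A∈) of λ
          h@(β , β∈ , A⊆β , _) → β , β∈ , A⊆β , proj₂ h

        strict-supremum-unique : ∀ {A β β′} → StrictSupremum A β → StrictSupremum A β′ → β ≡ β′
        strict-supremum-unique {A} = least-unique (A ⊆_)

      opaque
        absorbs : Fm 2
        absorbs = ∀ᶠ (v0 ∈ᶠ con 𝒜 ⇒ᶠ letᶠ (v0 ∩ᵗ v1) (big [ 0F ∷ [] ]) ⇒ᶠ v0 ⊆ᶠ v2)

      Absorbs : V → V → Set ℓ
      Absorbs α β = ⟦ absorbs ⟧ (α ∷ β ∷ [])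

      opaque
        unfolding absorbs

        absorbed : ∀ {α β A} → Absorbs α β → A ∈ 𝒜 → Big (A ∩ α) → A ⊆ β
        absorbed h A∈ b = h _ A∈ b

        absorbs-intro : ∀ {α β} → (∀ A → A ∈ 𝒜 → Big (A ∩ α) → A ⊆ β) → Absorbs α β
        absorbs-intro h = h

      -- The suprema of the members with big trace on `α` are indexed by the stages at which these
      -- members are reached, with finite fibres, hence bounded.
      absorbs-exists : ∀ {α} → α ∈ ω₁ → ∃[ β ] (β ∈ ω₁ × Absorbs α β)
      absorbs-exists {α} α∈ =
        case countable⇒bounded
          (∃ᶠ (v0 ∈ᶠ con 𝒜 ∧ᶠ letᶠ (con α) (reaches [ 0F ∷ 2F ∷ 1F ∷ [] ])
             ∧ᶠ strict-supremum [ 0F ∷ 2F ∷ [] ]))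
          {sep ω₁ suprema} (λ t t∈ → proj₁ (to (∈sep suprema) t∈))
          (λ t t∈ → case to (∈sep suprema) t∈ of λ (_ , A , A∈ , b , s) →
            case big⇒reaches α∈ b of λ (m , m∈ , r) → m , m∈ , A , A∈ , r , s)
          (λ m m∈ → case finitely-many-reach α m∈ of λ (S , fS , p) →
            case finite-⋃ strict-supremum fS
                   (λ A _ → subsingleton-finite _ λ β β′ → strict-supremum-unique) of λ
              (s , fs , q) → s , fs , λ t _ (A , A∈ , r , h) → q A (p A A∈ r) t h) of λ
          (β , β∈ , h) → β , β∈ , absorbs-intro λ A A∈ b x x∈A →
            case strict-supremum-exists A∈ of λ (γ , γ∈ , A⊆γ , s) →
              ∈-trans β∈ (A⊆γ x x∈A) (h γ (from (∈sep suprema) (γ∈ , A , A∈ , b , s)))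
        where
          suprema : Fm 1
          suprema = ∃ᶠ (v0 ∈ᶠ con 𝒜 ∧ᶠ letᶠ (v0 ∩ᵗ con α) (big [ 0F ∷ [] ])
            ∧ᶠ strict-supremum [ 0F ∷ 1F ∷ [] ])

      -- Iterating α ↦ least β absorbing α: iterate k x says that x is the k-th
      -- value, starting from α₀.

      module Iteration {α₀ : V} (α₀∈ : α₀ ∈ ω₁) where

        next : Fm 2
        next = v1 ∈ᶠ con ω₁ ∧ᶠ absorbs ∧ᶠ (∀ᶠ (v0 ∈ᶠ con ω₁ ⇒ᶠ absorbs [ 1F ∷ 0F ∷ [] ] ⇒ᶠ ¬ᶠ v0 ∈ᶠ v2))

        Next : V → V → Set ℓ
        Next x y = ⟦ next ⟧ (x ∷ y ∷ [])

        next-exists : ∀ {x} → x ∈ ω₁ → ∃[ y ] Next x y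
        next-exists {x} x∈ = least (letᶠ (con x) (absorbs [ 0F ∷ 1F ∷ [] ])) (absorbs-exists x∈)

        next-unique : ∀ {x y y′} → Next x y → Next x y′ → y ≡ y′
        next-unique {x} = least-unique (Absorbs x)

        opaque
          -- Recursion as a least fixed point: the pair belongs to every set that contains the start
          -- and is closed under the step.
          iterate : Fm 2
          iterate = ∀ᶠ (⟨ con ∅ , con α₀ ⟩ᵗ ∈ᶠ v0 ⇒ᶠ
            (∀ᶠ ∀ᶠ ∀ᶠ (⟨ v2 , v1 ⟩ᵗ ∈ᶠ v3 ⇒ᶠ next [ 1F ∷ 0F ∷ [] ] ⇒ᶠ
              ⟨ v2 ∪ᵗ pair v2 v2 , v0 ⟩ᵗ ∈ᶠ v3)) ⇒ᶠ
            ⟨ v1 , v2 ⟩ᵗ ∈ᶠ v0)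

        Iterate : V → V → Set ℓ
        Iterate k x = ⟦ iterate ⟧ (k ∷ x ∷ [])

        inversion : Fm 2
        inversion = (v0 ≡ᶠ con ∅ ∧ᶠ v1 ≡ᶠ con α₀) ∨ᶠ
          ∃ᶠ ∃ᶠ (iterate [ 1F ∷ 0F ∷ [] ] ∧ᶠ v2 ≡ᶠ v1 ∪ᵗ pair v1 v1 ∧ᶠ next [ 0F ∷ 3F ∷ [] ])

        opaque
          unfolding iterate

          iterate-zero : Iterate ∅ α₀
          iterate-zero Z z s = z

          iterate-suc : ∀ {k x y} → Iterate k x → Next x y → Iterate (k ⁺) y
          iterate-suc h p Z z s = s _ _ _ (h Z z s) p

          -- Leastness is applied to the pairs in `ω` and `ω₁` that satisfy `inversion`. That set is
          -- closed under the step because `recover` turns such a pair back into an iterate.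
          iterate-inversion : ∀ {k x} → Iterate k x → k ∈ ω × x ∈ ω₁ × ⟦ inversion ⟧ (k ∷ x ∷ [])
          iterate-inversion h = to (∈graph inversion) (h (graph ω ω₁ inversion)
            (from (∈graph inversion) (∅∈ω , α₀∈ , inj₁ (refl , refl)))
            λ k x y m p → case to (∈graph inversion) m of λ (k∈ , x∈ , i) →
              from (∈graph inversion) (⁺∈ω k∈ , proj₁ p , inj₂ (k , x , recover i , refl , p)))
            where
              recover : ∀ {k x} → ⟦ inversion ⟧ (k ∷ x ∷ []) → Iterate k x
              recover (inj₁ (refl , refl))         = iterate-zero
              recover (inj₂ (j , y , i , refl , p)) = iterate-suc i p

        iterate-unique : ∀ {k} → k ∈ ω → ∀ x y → Iterate k x → Iterate k y → x ≡ y
        iterate-unique = ω-induction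
          (∀ᶠ ∀ᶠ (iterate [ 2F ∷ 1F ∷ [] ] ⇒ᶠ iterate [ 2F ∷ 0F ∷ [] ] ⇒ᶠ v1 ≡ᶠ v0))
          (λ x y p q → case iterate-inversion p , iterate-inversion q of λ where
            ((_ , _ , inj₁ (_ , refl)) , (_ , _ , inj₁ (_ , refl)))  → refl
            ((_ , _ , inj₁ _) , (_ , _ , inj₂ (_ , _ , _ , e , _))) → ⊥-elim (∅≢⁺ e)
            ((_ , _ , inj₂ (_ , _ , _ , e , _)) , _)                → ⊥-elim (∅≢⁺ e))
          (λ k k∈ ih x y p q → case iterate-inversion p , iterate-inversion q of λ where
            ((_ , _ , inj₁ (e , _)) , _)                            → ⊥-elim (∅≢⁺ (sym e))
            ((_ , _ , inj₂ _) , (_ , _ , inj₁ (e , _)))             → ⊥-elim (∅≢⁺ (sym e))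
            ((_ , _ , inj₂ (j , z , i , e , r)) , (_ , _ , inj₂ (j′ , z′ , i′ , e′ , r′))) →
              case ⁺-injective e , ⁺-injective e′ of λ { (refl , refl) →
                next-unique (subst (λ w → Next w x) (ih z z′ i i′) r) r′ })

        iterates : V
        iterates = sep ω₁ (∃ᶠ (iterate [ 0F ∷ 1F ∷ [] ]))

        ∈iterates : ∀ {x} → x ∈ iterates ⇔ (∃[ k ] Iterate k x)
        ∈iterates = mk⇔ (proj₂ ∘ to (∈sep _))
          (λ (k , h) → from (∈sep _) (proj₁ (proj₂ (iterate-inversion h)) , k , h))

        iterates⊆ω₁ : iterates ⊆ ω₁
        iterates⊆ω₁ x = proj₁ ∘ to (∈sep _)

        bounded : ∃[ β ] (β ∈ ω₁ × iterates ⊆ β)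
        bounded = countable⇒bounded iterate iterates⊆ω₁
          (λ t t∈ → case to ∈iterates t∈ of λ (k , h) → k , proj₁ (iterate-inversion h) , h)
          (λ m m∈ → case subsingleton-finite (Iterate m) (iterate-unique m∈) of λ
            (s , fs , p) → s , fs , λ t _ → p t)

        -- Let `d` be the supremum of the iterates. A big trace on `d` is already big on one
        -- iterate, so the member lies in the next iterate, which is contained in `d`.
        closed-above : ∃[ d ] (d ∈ ω₁ × α₀ ⊆ d × Absorbs d d)
        closed-above =
          case bounded of λ (β , β∈ , h) →
          case least (∀ᶠ (v0 ∈ᶠ con iterates ⇒ᶠ v0 ⊆ᶠ v1))
                 (β , β∈ , λ t t∈ z z∈ → ∈-trans β∈ z∈ (h t t∈)) of λ
            (d , d∈ , upper , min) → d , d∈ , upper α₀ (from ∈iterates (∅ , iterate-zero)) ,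
              absorbs-intro λ A A∈ b →
                case big-chain (ordinals-chain iterates⊆ω₁) b
                  -- Leastness of `d`: if no iterate contained `x`, then `x` would be a smaller
                  -- upper bound.
                  (λ x x∈ → let x∈d = proj₂ (to ∈∩ x∈) ; x∈ω₁ = member-⊆ d∈ x x∈d in
                    by-contradiction λ ¬∃ → min x x∈ω₁
                      (λ t t∈ → ∉⇒⊆ x∈ω₁ (iterates⊆ω₁ t t∈) λ x∈t → ¬∃ (t , t∈ , x∈t)) x∈d) of λ
                  (t , t∈ , b′) →
                case to ∈iterates t∈ of λ (k , i) →
                case next-exists (iterates⊆ω₁ t t∈) of λ (y , p) →
                  λ x x∈A → upper y (from ∈iterates (k ⁺ , iterate-suc i p)) x
                    (absorbed (proj₁ (proj₂ p)) A∈
                      (big-monotone (λ z z∈ → let q , r = to ∈∩ z∈ in from ∈∩ (proj₁ (to ∈∩ q) , r)) b′)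
                      x x∈A)

      -- Levels and the finite sets to delete.

      closed : V
      closed = sep ω₁ (absorbs [ 0F ∷ 0F ∷ [] ])

      closed⊆ω₁ : closed ⊆ ω₁
      closed⊆ω₁ x = proj₁ ∘ to (∈sep _)

      opaque
        level : Fm 2
        level = v1 ∈ᶠ con ω₁ ∧ᶠ (v1 ∈ᶠ con closed ∧ᶠ letᶠ (v0 ∩ᵗ v1) (big [ 0F ∷ [] ]))
          ∧ᶠ (∀ᶠ (v0 ∈ᶠ con ω₁ ⇒ᶠ v0 ∈ᶠ con closed ∧ᶠ letᶠ (v1 ∩ᵗ v0) (big [ 0F ∷ [] ]) ⇒ᶠ ¬ᶠ v0 ∈ᶠ v2))

      HasLevel : V → V → Set ℓ
      HasLevel A d = ⟦ level ⟧ (A ∷ d ∷ [])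

      opaque
        unfolding level

        level-exists : ∀ {A} → A ∈ 𝒜 → ∃[ d ] HasLevel A d
        level-exists {A} A∈ =
          case member-bounded A∈ of λ (β , β∈ , A⊆β) →
          case Iteration.closed-above β∈ of λ (d , d∈ , β⊆d , c) →
            least (v0 ∈ᶠ con closed ∧ᶠ letᶠ (con A ∩ᵗ v0) (big [ 0F ∷ [] ]))
              (d , d∈ , from (∈sep _) (d∈ , c) ,
               big-monotone (λ z z∈ → from ∈∩ (z∈ , β⊆d z (A⊆β z z∈))) (member-big A∈))

        level-unique : ∀ {A d d′} → HasLevel A d → HasLevel A d′ → d ≡ d′
        level-unique {A} = least-unique (λ d → d ∈ closed × Big (A ∩ d))

        level-closed : ∀ {A d} → HasLevel A d → d ∈ closed
        level-closed (_ , (c , _) , _) = c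

        level-big : ∀ {A d} → HasLevel A d → Big (A ∩ d)
        level-big (_ , (_ , b) , _) = b

        level-least : ∀ {A d z} → HasLevel A d → z ∈ closed → z ∈ d → ¬ Big (A ∩ z)
        level-least (d∈ , _ , h) c z∈ b = h _ (closed⊆ω₁ _ c) (c , b) z∈

      level∈ω₁ : ∀ {A d} → HasLevel A d → d ∈ ω₁
      level∈ω₁ h = closed⊆ω₁ _ (level-closed h)

      ⊆level : ∀ {A d} → A ∈ 𝒜 → HasLevel A d → A ⊆ d
      ⊆level A∈ h =
        absorbed (proj₂ (to (∈sep (absorbs [ 0F ∷ 0F ∷ [] ])) (level-closed h))) A∈ (level-big h)

      opaque
        below-level : Fm 2
        below-level = ∃ᶠ ∃ᶠ (level [ 3F ∷ 1F ∷ [] ] ∧ᶠ v0 ∈ᶠ con closed ∧ᶠ v0 ∈ᶠ v1 ∧ᶠ v2 ∈ᶠ v0)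

        -- precedes B A: B lies on the level of A and is reached no later than A.

        precedes : Fm 2
        precedes = ∃ᶠ (level [ 1F ∷ 0F ∷ [] ] ∧ᶠ level [ 2F ∷ 0F ∷ [] ] ∧ᶠ
          (∀ᶠ (v0 ∈ᶠ con ω ⇒ᶠ reaches [ 1F ∷ 0F ∷ 3F ∷ [] ] ⇒ᶠ reaches [ 1F ∷ 0F ∷ 2F ∷ [] ])))

        deleted : Fm 2
        deleted = below-level ∨ᶠ ∃ᶠ (v0 ∈ᶠ con 𝒜 ∧ᶠ ¬ᶠ v0 ≡ᶠ v2 ∧ᶠ precedes [ 0F ∷ 2F ∷ [] ] ∧ᶠ v1 ∈ᶠ v0)

      BelowLevel Precedes Deleted : V → V → Set ℓ
      BelowLevel x A = ⟦ below-level ⟧ (x ∷ A ∷ [])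
      Precedes B A   = ⟦ precedes ⟧ (B ∷ A ∷ [])
      Deleted x A    = ⟦ deleted ⟧ (x ∷ A ∷ [])

      opaque
        unfolding deleted

        deleted⇔ : ∀ {x A} → Deleted x A ⇔
          (BelowLevel x A ⊎ ∃[ B ] (B ∈ 𝒜 × B ≢ A × Precedes B A × x ∈ B))
        deleted⇔ = mk⇔ id id

        below-level-intro : ∀ {x A d z} → HasLevel A d → z ∈ closed → z ∈ d → x ∈ z → BelowLevel x A
        below-level-intro {d = d} {z} h c z∈ x∈ = d , z , h , c , z∈ , x∈

        -- Since `Reaches` is monotone in the stage, first stages are compared without being named.
        -- In a tie each member precedes the other, and common points are deleted from both.
        precedes-total : ∀ {A B d} → HasLevel A d → HasLevel B d → Precedes A B ⊎ Precedes B A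
        precedes-total {A} {B} {d} p q with em {∃[ m ] (m ∈ ω × Reaches d m A × ¬ Reaches d m B)}
        ... | no ¬∃ = inj₂ (d , q , p , λ m m∈ r → by-contradiction λ ¬r → ¬∃ (m , m∈ , r , ¬r))
        ... | yes (m , m∈ , r , ¬r) = inj₁ (d , p , q , λ k k∈ s →
                reaches-monotone (∉⇒⊆ (ω⊆ω₁ k k∈) (ω⊆ω₁ m m∈) λ k∈m →
                  ¬r (reaches-monotone (λ z z∈ → ∈-trans (ω⊆ω₁ m m∈) z∈ k∈m) s)) r)

        -- Any stage `m` that reaches `A` also reaches every `B` preceding `A`.
        finitely-many-precede : ∀ {A} → A ∈ 𝒜 →
          ∃[ T ] (IsFinite T × (∀ B → B ∈ 𝒜 → Precedes B A → B ∈ T))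
        finitely-many-precede {A} A∈ =
          case level-exists A∈ of λ (d , h) →
          case big⇒reaches (level∈ω₁ h) (level-big h) of λ (m , m∈ , r) →
          case finitely-many-reach d m∈ of λ (T , fT , p) →
            T , fT , λ B B∈ (d′ , _ , h′ , q) → case level-unique h h′ of λ { refl → p B B∈ (q m m∈ r) }

        -- The smaller closed ordinals form a chain, so a big union of traces would give a big trace
        -- on one of them, against the leastness of the level.
        below-level-finite : ∀ {A} → A ∈ 𝒜 →
          ∃[ t ] (IsFinite t × (∀ x → x ∈ A → BelowLevel x A → x ∈ t))
        below-level-finite {A} A∈ = U , small⇒finite small , λ x x∈ b → from (∈sep φ) (x∈ , b)
          where
            φ : Fm 1
            φ = letᶠ (con A) (below-level [ 1F ∷ 0F ∷ [] ])
            U : V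
            U = sep A φ
            𝒞φ : Fm 1
            𝒞φ = ∃ᶠ (letᶠ (con A) (level [ 0F ∷ 1F ∷ [] ]) ∧ᶠ v1 ∈ᶠ v0)
            𝒞 : V
            𝒞 = sep closed 𝒞φ
            small : ¬ Big U
            small b =
              case big-chain {𝒞} (ordinals-chain λ z → closed⊆ω₁ z ∘ proj₁ ∘ to (∈sep 𝒞φ)) b
                (λ x x∈ → case to (∈sep φ) x∈ of λ (_ , d , z , h , c , z∈ , x∈z) →
                  z , from (∈sep 𝒞φ) (c , d , h , z∈) , x∈z) of λ
                (z , z∈𝒞 , b′) → case to (∈sep 𝒞φ) z∈𝒞 of λ (c , d , h , z∈) →
                  level-least h c z∈ (big-monotone (λ x x∈ → let p , q = to ∈∩ x∈ in
                    from ∈∩ (proj₁ (to (∈sep φ) p) , q)) b′)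

      deletion : V → V
      deletion A = sep A (letᶠ (con A) (deleted [ 1F ∷ 0F ∷ [] ]))

      ∈deletion : ∀ {A x} → x ∈ deletion A ⇔ (x ∈ A × Deleted x A)
      ∈deletion = ∈sep _

      deletion-finite : ∀ {A} → A ∈ 𝒜 → IsFinite (deletion A)
      deletion-finite {A} A∈ =
        case below-level-finite A∈ of λ (U , fU , p) →
        case finitely-many-precede A∈ of λ (T , fT , q) →
        case finite-⋃ (v0 ∈ᶠ con 𝒜 ∧ᶠ ¬ᶠ v0 ≡ᶠ con A ∧ᶠ v1 ∈ᶠ con A ∩ᵗ v0) fT
          (λ B _ → case em {B ∈ 𝒜 × B ≢ A} of λ where
            (yes (B∈ , B≢A)) → A ∩ B , small⇒finite (intersection-small A∈ B∈ (B≢A ∘ sym)) ,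
                               λ x (_ , _ , x∈) → x∈
            (no h) → ∅ , finite-∅ , λ x (B∈ , B≢A , _) → ⊥-elim (h (B∈ , B≢A))) of λ
          (W , fW , r) → finite-⊆ (finite-∪ fU fW) λ x x∈ → case to ∈deletion x∈ of λ (x∈A , h) →
            from ∈∪ (case to deleted⇔ h of λ where
              (inj₁ b) → inj₁ (p x x∈A b)
              (inj₂ (B , B∈ , B≢A , s , x∈B)) →
                inj₂ (r B (q B B∈ s) x (B∈ , B≢A , from ∈∩ (x∈A , x∈B))))

      -- A member is contained in its level. If the levels differ, a common point therefore lies in
      -- the smaller one, which is closed and below the other level; on equal levels the order of
      -- reaching decides.
      common-deleted : ∀ {A B x} → A ∈ 𝒜 → B ∈ 𝒜 → A ≢ B → x ∈ A → x ∈ B → Deleted x A ⊎ Deleted x B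
      common-deleted {A} {B} {x} A∈ B∈ A≢B x∈A x∈B =
        case level-exists A∈ of λ (d , h) →
        case level-exists B∈ of λ (e , k) →
        case compare (level∈ω₁ h) (level∈ω₁ k) of λ where
          (inj₁ d∈e) → inj₂ (from deleted⇔ (inj₁
            (below-level-intro k (level-closed h) d∈e (⊆level A∈ h x x∈A))))
          (inj₂ (inj₂ e∈d)) → inj₁ (from deleted⇔ (inj₁
            (below-level-intro h (level-closed k) e∈d (⊆level B∈ k x x∈B))))
          (inj₂ (inj₁ refl)) → case precedes-total h k of λ where
            (inj₁ p) → inj₂ (from deleted⇔ (inj₂ (A , A∈ , A≢B , p , x∈A)))
            (inj₂ p) → inj₁ (from deleted⇔ (inj₂ (B , B∈ , A≢B ∘ sym , p , x∈B)))

      is-deletion : Fm 2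
      is-deletion = ∀ᶠ ((v0 ∈ᶠ v2 ⇒ᶠ v0 ∈ᶠ v1 ∧ᶠ deleted [ 0F ∷ 1F ∷ [] ]) ∧ᶠ
                        (v0 ∈ᶠ v1 ∧ᶠ deleted [ 0F ∷ 1F ∷ [] ] ⇒ᶠ v0 ∈ᶠ v2))

      is-deletion⇒≡ : ∀ {A F} → ⟦ is-deletion ⟧ (A ∷ F ∷ []) → F ≡ deletion A
      is-deletion⇒≡ h = ext (λ x → from ∈deletion ∘ proj₁ (h x)) (λ x → proj₂ (h x) ∘ to ∈deletion)

      essentially-disjoint : EssentiallyDisjoint ω 𝒜
      essentially-disjoint = f , proj₁ f-map , f-values , disjoint
        where
          f : V
          f = graph 𝒜 (𝒫 ω₁) is-deletion
          f-map : f ∶ 𝒜 ⟶ 𝒫 ω₁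
          f-map = graph-map is-deletion
            (λ A A∈ → deletion A ,
              from ∈𝒫 (λ x x∈ → proj₁ (members A A∈) x (proj₁ (to ∈deletion x∈))) ,
              λ x → to ∈deletion , from ∈deletion)
            (λ A F F′ _ _ _ p q → trans (is-deletion⇒≡ p) (sym (is-deletion⇒≡ q)))
          f-value : ∀ {A F} → ⟨ A , F ⟩ ∈ f → A ∈ 𝒜 × F ≡ deletion A
          f-value h = case to (∈graph is-deletion) h of λ (A∈ , _ , p) → A∈ , is-deletion⇒≡ p
          f-values : ∀ A F → ⟨ A , F ⟩ ∈ f → F ⊆ A × Finite ω F
          f-values A F h = case f-value h of λ { (A∈ , refl) →
            (λ x → proj₁ ∘ to ∈deletion) , finite⇒Finite (deletion-finite A∈) }
          disjoint : ∀ A B F G → ⟨ A , F ⟩ ∈ f → ⟨ B , G ⟩ ∈ f → A ≢ B → (A ∖ F) ∩ (B ∖ G) ≡ ∅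
          disjoint A B F G p q A≢B = case f-value p of λ { (A∈ , refl) → case f-value q of λ { (B∈ , refl) →
            ext (λ x x∈ → let r , s = to ∈∩ x∈ ; x∈A , x∉F = to ∈∖ r ; x∈B , x∉G = to ∈∖ s in
              case common-deleted A∈ B∈ A≢B x∈A x∈B of λ where
                (inj₁ h) → ⊥-elim (x∉F (from ∈deletion (x∈A , h)))
                (inj₂ h) → ⊥-elim (x∉G (from ∈deletion (x∈B , h))))
            (λ _ → ⊥-elim ∘ ∉∅) } }

  -- Part (2): a family refuting essential disjointness from a short cofinal map.

  module Cofinality {ω ω₁ : V} (isω : IsOmega ω) (isω₁ : IsOmega₁ ω ω₁) where

    open OmegaOne isω isω₁
    open Counting isω isω₁

    -- root x l: l is the largest limit ordinal (or 0) below or equal to x,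
    -- characterised as the least ordinal from which x differs by a finite set.

    root : Fm 2
    root = v1 ∈ᶠ con ω₁ ∧ᶠ letᶠ (v0 ∖ᵗ v1) (fin [ 0F ∷ [] ])
      ∧ᶠ (∀ᶠ (v0 ∈ᶠ con ω₁ ⇒ᶠ letᶠ (v1 ∖ᵗ v0) (fin [ 0F ∷ [] ]) ⇒ᶠ ¬ᶠ v0 ∈ᶠ v2))

    Root : V → V → Set ℓ
    Root x l = ⟦ root ⟧ (x ∷ l ∷ [])

    ∖-self : ∀ {x} → x ∖ x ≡ ∅
    ∖-self = ext (λ z h → let p , q = to ∈∖ h in ⊥-elim (q p)) (λ _ → ⊥-elim ∘ ∉∅)

    ∖-self-finite : ∀ {x} → IsFinite (x ∖ x)
    ∖-self-finite = subst IsFinite (sym ∖-self) finite-∅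

    root-exists : ∀ {x} → x ∈ ω₁ → ∃[ l ] Root x l
    root-exists {x} x∈ = least (letᶠ (con x ∖ᵗ v0) (fin [ 0F ∷ [] ])) (x , x∈ , ∖-self-finite)

    root-unique : ∀ {x l l′} → Root x l → Root x l′ → l ≡ l′
    root-unique {x} = least-unique (λ l → IsFinite (x ∖ l))

    ⁺∖ : ∀ {x l} → ¬ x ∈ l → x ⁺ ∖ l ≡ (x ∖ l) ⊕ x
    ⁺∖ x∉l = ext
      (λ z h → let p , q = to ∈∖ h in
        from ∈⊕ ([ (λ r → inj₁ (from ∈∖ (r , q))) , inj₂ ]′ (to ∈⊕ p)))
      (λ z h → case to ∈⊕ h of λ where
        (inj₁ p)    → let r , q = to ∈∖ p in from ∈∖ (⊕-old r , q)
        (inj₂ refl) → from ∈∖ (⊕-new , x∉l))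

    root-∉ : ∀ {x l} → x ∈ ω₁ → Root x l → ¬ x ∈ l
    root-∉ {x} x∈ (_ , _ , h) = h x x∈ ∖-self-finite

    root-⁺ : ∀ {x l} → x ∈ ω₁ → Root x l → Root (x ⁺) l
    root-⁺ {x} x∈ r@(l∈ , p , h) =
      l∈ , subst IsFinite (sym (⁺∖ (root-∉ x∈ r))) (finite-⊕ p) ,
      λ z z∈ q → h z z∈ (finite-⊆ q λ w w∈ → let a , b = to ∈∖ w∈ in from ∈∖ (⊕-old a , b))

    -- `x ∖ z` is covered by `x ∖ l` and `l ∖ z`, so an ordinal at finite distance below `l` would
    -- also be at finite distance from `x`.
    root-root : ∀ {x l} → Root x l → Root l l
    root-root {x} {l} (l∈ , p , h) = l∈ , ∖-self-finite , λ z z∈ q → h z z∈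
      (finite-⊆ (finite-∪ p q) λ w w∈ → let a , b = to ∈∖ w∈ in from ∈∪ (case em {w ∈ l} of λ where
        (yes w∈l) → inj₂ (from ∈∖ (w∈l , b))
        (no w∉l)  → inj₁ (from ∈∖ (a , w∉l))))

    -- offset x l k: x = l + k with l the root of x.

    offset : Fm 3
    offset = root [ 0F ∷ 1F ∷ [] ] ∧ᶠ v2 ∈ᶠ con ω ∧ᶠ letᶠ (v0 ∖ᵗ v1) (equinumerous [ 0F ∷ 3F ∷ [] ])

    Offset : V → V → V → Set ℓ
    Offset x l k = ⟦ offset ⟧ (x ∷ l ∷ k ∷ [])

    offset-exists : ∀ {x l} → Root x l → ∃[ k ] Offset x l k
    offset-exists r@(_ , p , _) = case finite⇒≃ p of λ (k , k∈ , s≃) → k , r , k∈ , s≃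

    offset-unique : ∀ {x l l′ k k′} → Offset x l k → Offset x l′ k′ → k ≡ k′
    offset-unique (r , k∈ , p) (r′ , k′∈ , q) with root-unique r r′
    ... | refl = ≃-unique k∈ k′∈ p q

    -- If `x ∈ y`, then `x ∖ l` and `y ∖ l` are nested and of the same finite size, hence equal, yet
    -- `x` belongs only to the second.
    offset-≮ : ∀ {x y l k} → x ∈ ω₁ → y ∈ ω₁ → Offset x l k → Offset y l k → ¬ x ∈ y
    offset-≮ {x} {y} {l} x∈ y∈ (r , k∈ , p) (_ , _ , q) x∈y =
      ∈-irrefl (proj₁ (to ∈∖ (≃-⊆⇒⊇ k∈ p q
        (∖-mono λ z z∈x → ∈-trans y∈ z∈x x∈y)
        x (from ∈∖ (x∈y , root-∉ x∈ r)))))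

    offset-injective : ∀ {x y l k} → x ∈ ω₁ → y ∈ ω₁ → Offset x l k → Offset y l k → x ≡ y
    offset-injective x∈ y∈ p q with compare x∈ y∈
    ... | inj₁ r        = ⊥-elim (offset-≮ x∈ y∈ p q r)
    ... | inj₂ (inj₁ r) = r
    ... | inj₂ (inj₂ r) = ⊥-elim (offset-≮ y∈ x∈ q p r)

    offset-onto : ∀ {l k} → Root l l → k ∈ ω → ∃[ x ] (x ∈ ω₁ × Offset x l k)
    offset-onto {l} r = ω-induction
      (∃ᶠ (v0 ∈ᶠ con ω₁ ∧ᶠ letᶠ (con l) (offset [ 1F ∷ 0F ∷ 2F ∷ [] ])))
      (l , proj₁ r , r , ∅∈ω , subst (_≃ ∅) (sym ∖-self) ∅≃∅)
      (λ k k∈ (x , x∈ , r , _ , s≃) → x ⁺ , ⁺∈ω₁ x∈ , root-⁺ x∈ r , ⁺∈ω k∈ ,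
        subst (_≃ k ⁺) (sym (⁺∖ (root-∉ x∈ r))) (≃-⊕ s≃ (λ h → ∈-irrefl (proj₁ (to ∈∖ h)))))

    subsingleton⇒Card<𝟐 : ∀ {s} → (∀ x y → x ∈ s → y ∈ s → x ≡ y) → Card< s 𝟐
    subsingleton⇒Card<𝟐 {s} unique with empty-or-inhabited s
    ... | inj₁ refl     = ∅ , ⊕-old ⊕-new , ≃⇒≈ ∅≃∅
    ... | inj₂ (x , x∈) = 𝟏 , ⊕-new , ≃⇒≈ (subst (_≃ 𝟏)
            (ext (λ z z∈ → [ ⊥-elim ∘ ∉∅ , (λ { refl → x∈ }) ]′ (to ∈⊕ z∈))
                 (λ z z∈ → from ∈⊕ (inj₂ (unique z x z∈ x∈))))
            (≃-⊕ ∅≃∅ ∉∅))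

    module Grid {γ g : V} (γ∈ : γ ∈ ω₁) (cofinal : Cofinal g γ ω₁) where

      g-function : FunctionOn g γ
      g-function = proj₁ (proj₁ cofinal)

      -- On ordinals the inclusion expresses that `x` is at most the value of `g` at the given
      -- argument.
      bound : Fm 2
      bound = v1 ∈ᶠ con γ ∧ᶠ ∃ᶠ (⟨ v2 , v0 ⟩ᵗ ∈ᶠ con g ∧ᶠ v1 ⊆ᶠ v0)

      stage : Fm 2
      stage = v1 ∈ᶠ con ω₁ ∧ᶠ bound ∧ᶠ (∀ᶠ (v0 ∈ᶠ con ω₁ ⇒ᶠ bound [ 1F ∷ 0F ∷ [] ] ⇒ᶠ ¬ᶠ v0 ∈ᶠ v2))

      stage-exists : ∀ {x} → x ∈ ω₁ → ∃[ η ] ⟦ stage ⟧ (x ∷ η ∷ [])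
      stage-exists {x} x∈ with proj₂ cofinal x x∈
      ... | η , ζ , h , x≤ζ with argument g-function h
      ... | η∈γ = least (letᶠ (con x) (bound [ 0F ∷ 1F ∷ [] ]))
        (η , member-⊆ γ∈ η η∈γ , η∈γ , ζ , h , [ (λ p z z∈ → ∈-trans (proj₂ (proj₁ cofinal) _ _ h) z∈ p)
                                               , (λ { refl _ → id }) ]′ x≤ζ)

      stage-unique : ∀ {x η η′} → ⟦ stage ⟧ (x ∷ η ∷ []) → ⟦ stage ⟧ (x ∷ η′ ∷ []) → η ≡ η′
      stage-unique {x} = least-unique (λ η → ⟦ bound ⟧ (x ∷ η ∷ []))

      columnᶠ : Fm 2
      columnᶠ = v0 ∈ᶠ con ω₁ ∧ᶠ root

      rowᶠ : Fm 3
      rowᶠ = v0 ∈ᶠ con ω₁ ∧ᶠ stage [ 0F ∷ 1F ∷ [] ] ∧ᶠ ∃ᶠ (offset [ 1F ∷ 0F ∷ 3F ∷ [] ])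

      opaque
        is-column : Fm 2
        is-column = ∀ᶠ ((v0 ∈ᶠ v1 ⇒ᶠ columnᶠ [ 0F ∷ 2F ∷ [] ]) ∧ᶠ (columnᶠ [ 0F ∷ 2F ∷ [] ] ⇒ᶠ v0 ∈ᶠ v1))

        is-row : Fm 3
        is-row = ∀ᶠ ((v0 ∈ᶠ v1 ⇒ᶠ rowᶠ [ 0F ∷ 2F ∷ 3F ∷ [] ]) ∧ᶠ (rowᶠ [ 0F ∷ 2F ∷ 3F ∷ [] ] ⇒ᶠ v0 ∈ᶠ v1))

        column : V → V
        column l = sep ω₁ (letᶠ (con l) (root [ 1F ∷ 0F ∷ [] ]))

        row : V → V → V
        row η k = sep ω₁ (letᶠ (con η) (letᶠ (con k)
          (stage [ 2F ∷ 1F ∷ [] ] ∧ᶠ ∃ᶠ (offset [ 3F ∷ 0F ∷ 1F ∷ [] ]))))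

      IsColumn : V → V → Set ℓ
      IsColumn A l = ⟦ is-column ⟧ (A ∷ l ∷ [])

      IsRow : V → V → V → Set ℓ
      IsRow A η k = ⟦ is-row ⟧ (A ∷ η ∷ k ∷ [])

      opaque
        unfolding is-column

        ∈column : ∀ {A l x} → IsColumn A l → x ∈ A ⇔ ⟦ columnᶠ ⟧ (x ∷ l ∷ [])
        ∈column p = let f , g = p _ in mk⇔ f g

        ∈row : ∀ {A η k x} → IsRow A η k → x ∈ A ⇔ ⟦ rowᶠ ⟧ (x ∷ η ∷ k ∷ [])
        ∈row p = let f , g = p _ in mk⇔ f g

        column-is-column : ∀ l → IsColumn (column l) l
        column-is-column l x = to (∈sep _) , from (∈sep _)

        row-is-row : ∀ η k → IsRow (row η k) η k
        row-is-row η k x = to (∈sep _) , from (∈sep _)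

      column-unique : ∀ {A B l} → IsColumn A l → IsColumn B l → A ≡ B
      column-unique p q = ext (λ z → from (∈column q) ∘ to (∈column p))
                              (λ z → from (∈column p) ∘ to (∈column q))

      row-unique : ∀ {A B η k} → IsRow A η k → IsRow B η k → A ≡ B
      row-unique p q = ext (λ z → from (∈row q) ∘ to (∈row p))
                           (λ z → from (∈row p) ∘ to (∈row q))

      -- Equinumerosity with `ω` discards the finite rows and the empty columns over ordinals that
      -- are not roots.
      family : Fm 1
      family = letᶠ (con ω) (equinumerous [ 1F ∷ 0F ∷ [] ])
        ∧ᶠ (∃ᶠ (is-column [ 1F ∷ 0F ∷ [] ]) ∨ᶠ ∃ᶠ ∃ᶠ (is-row [ 2F ∷ 1F ∷ 0F ∷ [] ]))

      𝒜 : V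
      𝒜 = sep (𝒫 ω₁) family

      𝒜-members : ∀ A → A ∈ 𝒜 → A ⊆ ω₁ × A ≈ ω
      𝒜-members A h = let p , q , _ = to (∈sep family) h in to ∈𝒫 p , ≃⇒≈ q

      -- A common point has root `l` and offset `k`, and these two determine it.
      column-row : ∀ {A B l η k x y} → IsColumn A l → IsRow B η k →
                   x ∈ A → x ∈ B → y ∈ A → y ∈ B → x ≡ y
      column-row {x = x} {y} p q x∈A x∈B y∈A y∈B
        with to (∈column p) x∈A | to (∈row q) x∈B | to (∈column p) y∈A | to (∈row q) y∈B
      ... | x∈ , r | _ , _ , _ , o | y∈ , r′ | _ , _ , _ , o′
        with root-unique r (proj₁ o) | root-unique r′ (proj₁ o′)
      ... | refl | refl = offset-injective x∈ y∈ o o′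

      𝒜-almost-disjoint : AlmostDisjoint 𝟐 𝒜
      𝒜-almost-disjoint A B A∈ B∈ A≢B = subsingleton⇒Card<𝟐 λ x y x∈ y∈ →
        let x∈A , x∈B = to ∈∩ x∈
            y∈A , y∈B = to ∈∩ y∈
        in unique (proj₂ (proj₂ (to (∈sep family) A∈))) (proj₂ (proj₂ (to (∈sep family) B∈)))
             x y x∈A x∈B y∈A y∈B
        where
          unique : (∃[ l ] IsColumn A l) ⊎ (∃[ η ] ∃[ k ] IsRow A η k) →
                   (∃[ l ] IsColumn B l) ⊎ (∃[ η ] ∃[ k ] IsRow B η k) →
                   ∀ x y → x ∈ A → x ∈ B → y ∈ A → y ∈ B → x ≡ y
          unique (inj₁ (l , p)) (inj₂ (η , k , q)) x y x∈A x∈B y∈A y∈B = column-row p q x∈A x∈B y∈A y∈B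
          unique (inj₂ (η , k , q)) (inj₁ (l , p)) x y x∈A x∈B y∈A y∈B = column-row p q x∈B x∈A y∈B y∈A
          unique (inj₁ (l , p)) (inj₁ (l′ , q)) x y x∈A x∈B _ _
            with root-unique (proj₂ (to (∈column p) x∈A)) (proj₂ (to (∈column q) x∈B))
          ... | refl = ⊥-elim (A≢B (column-unique p q))
          unique (inj₂ (η , k , p)) (inj₂ (η′ , k′ , q)) x y x∈A x∈B _ _
            with to (∈row p) x∈A | to (∈row q) x∈B
          ... | _ , s , _ , o | _ , s′ , _ , o′ with stage-unique s s′ | offset-unique o o′
          ... | refl | refl = ⊥-elim (A≢B (row-unique p q))

      column≃ω : ∀ {l} → Root l l → column l ≃ ω
      column≃ω {l} r = graph-≃ (letᶠ (con l) (offset [ 1F ∷ 0F ∷ 2F ∷ [] ]))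
        (λ x x∈ → case offset-exists (proj₂ (in-column x∈)) of λ (k , o) → k , proj₁ (proj₂ o) , o)
        (λ k k∈ → case offset-onto r k∈ of λ (x , x∈ , o) →
          x , from (∈column (column-is-column l)) (x∈ , proj₁ o) , o)
        (λ x k k′ _ _ _ → offset-unique)
        (λ x y k x∈ y∈ _ → offset-injective (proj₁ (in-column x∈)) (proj₁ (in-column y∈)))
        where
          in-column : ∀ {x} → x ∈ column l → x ∈ ω₁ × Root x l
          in-column {x} = to (∈column (column-is-column l))

      column∈𝒜 : ∀ {l} → Root l l → column l ∈ 𝒜
      column∈𝒜 {l} r = from (∈sep family)
        ( from ∈𝒫 (λ x x∈ → proj₁ (to (∈column (column-is-column l)) x∈))
        , column≃ω r , inj₁ (l , column-is-column l))

      -- The row stays at or below `ζ`, the value of `g` at `η`, and `ζ ⁺` is countable.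
      infinite-row∈𝒜 : ∀ {A η k} → IsRow A η k → η ∈ γ → ¬ IsFinite A → A ∈ 𝒜
      infinite-row∈𝒜 {A} {η} {k} p η∈ inf with value g-function η∈
      ... | ζ , h with proj₂ (proj₁ cofinal) _ _ h
      ... | ζ∈ = from (∈sep family)
        ( from ∈𝒫 (λ x x∈ → proj₁ (to (∈row p) x∈))
        , ≈⇒≃ (infinite⊆countable⇒≈ω (proj₂ (proj₂ isω₁) (ζ ⁺) (⁺∈ω₁ ζ∈)) A⊆ζ⁺ inf)
        , inj₂ (η , k , p))
        where
          A⊆ζ⁺ : A ⊆ ζ ⁺
          A⊆ζ⁺ x x∈A with to (∈row p) x∈A
          ... | x∈ , (_ , (_ , ζ′ , h′ , x⊆ζ′) , _) , _ with value-unique g-function h h′ | compare x∈ ζ∈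
          ... | refl | inj₁ q           = ⊕-old q
          ... | refl | inj₂ (inj₁ refl) = ⊕-new
          ... | refl | inj₂ (inj₂ q)    = ⊥-elim (∈-irrefl (x⊆ζ′ ζ q))

      not-essentially-disjoint : ¬ EssentiallyDisjoint ω 𝒜
      not-essentially-disjoint (f , f-function , f-finite , disjoint)
        with proj₂ (proj₂ isω₁) γ γ∈
      ... | e , (e-function , e∈) , e-inj = ω₁-not-covered₃ piece finite cover
        where
          value-finite : ∀ A G → ⟨ A , G ⟩ ∈ f → IsFinite G
          value-finite A G h = Finite⇒finite (proj₂ (f-finite A G h))

          opaque
            -- For a row outside the domain of `f` the last clause is vacuous, so a finite row
            -- counts as deleted entirely.
            deleted : Fm 3
            deleted = ∃ᶠ (is-row [ 0F ∷ 2F ∷ 3F ∷ [] ] ∧ᶠ v1 ∈ᶠ v0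
              ∧ᶠ (∀ᶠ (⟨ v1 , v0 ⟩ᵗ ∈ᶠ con f ⇒ᶠ v2 ∈ᶠ v0)))

            deleted-⊆-row : ∀ {η k} y → ⟦ deleted ⟧ (y ∷ η ∷ k ∷ []) → y ∈ row η k
            deleted-⊆-row {η} {k} y (A , p , y∈A , _) = subst (y ∈_) (row-unique p (row-is-row η k)) y∈A

            deleted-⊆ : ∀ {η k G} → ⟨ row η k , G ⟩ ∈ f → ∀ y → ⟦ deleted ⟧ (y ∷ η ∷ k ∷ []) → y ∈ G
            deleted-⊆ {η} {k} {G} h y (A , p , _ , q) =
              q G (subst (λ B → ⟨ B , G ⟩ ∈ f) (row-unique (row-is-row η k) p) h)

            deleted-intro : ∀ {y η k} → y ∈ row η k → (∀ G → ⟨ row η k , G ⟩ ∈ f → y ∈ G) →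
                            ⟦ deleted ⟧ (y ∷ η ∷ k ∷ [])
            deleted-intro {y} {η} {k} y∈ h = row η k , row-is-row η k , y∈ , h

          same-column : Fm 3
          same-column = v1 ∈ᶠ con ω₁ ∧ᶠ ∃ᶠ (root [ 1F ∷ 0F ∷ [] ] ∧ᶠ offset [ 2F ∷ 0F ∷ 3F ∷ [] ])
          -- The indices are the offset `n` of `x`, the code `j` of a stage under `e`, and the
          -- offset `k` of `y`. A deleted `y` fixes the column, and `n` then fixes `x` in it.
          piece : Fm 4
          piece = ∃ᶠ ∃ᶠ (⟨ v0 , v3 ⟩ᵗ ∈ᶠ con e ∧ᶠ deleted [ 1F ∷ 0F ∷ 4F ∷ [] ]
            ∧ᶠ same-column [ 1F ∷ 5F ∷ 2F ∷ [] ])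

          deleted-finite : ∀ {η k} → η ∈ γ →
            ∃[ t ] (IsFinite t × (∀ y → ⟦ deleted ⟧ (y ∷ η ∷ k ∷ []) → y ∈ t))
          deleted-finite {η} {k} η∈ = case em {IsFinite (row η k)} of λ where
            (yes h) → row η k , h , deleted-⊆-row {η} {k}
            (no h)  → case value f-function (infinite-row∈𝒜 (row-is-row η k) η∈ h) of λ
              (G , q) → G , value-finite _ G q , deleted-⊆ {η} {k} {G} q

          -- The column is infinite and loses finitely many points, so some `y` survives there;
          -- disjointness forces `y` into the set deleted from any row of the family through it.
          not-deleted : ∀ {l} → Root l l → ∃[ y ] (y ∈ column l ×
            (∀ R η k → IsRow R η k → y ∈ R → ∀ H → ⟨ R , H ⟩ ∈ f → y ∈ H))
          not-deleted {l} r = case value f-function (column∈𝒜 r) of λ (G , h) →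
            case empty-or-inhabited (column l ∖ G) of λ where
              (inj₁ q) → ⊥-elim (infinite (finite-⊆ (value-finite _ G h) λ z z∈ →
                by-contradiction λ z∉ → ∉∅ (subst (z ∈_) q (from ∈∖ (z∈ , z∉)))))
              (inj₂ (y , y∈∖)) → y , proj₁ (to ∈∖ y∈∖) , λ R η k p y∈R H hH →
                by-contradiction λ y∉H → ∉∅ (subst (y ∈_)
                  (disjoint _ _ _ _ h hH (column≢row {R} {η} {k} p))
                  (from ∈∩ (y∈∖ , from ∈∖ (y∈R , y∉H))))
            where
              infinite : ¬ IsFinite (column l)
              infinite = ≈ω⇒infinite (≃⇒≈ (column≃ω r))
              -- A column that is also a row would have at most one point, by `column-row`.
              column≢row : ∀ {R η k} → IsRow R η k → column l ≢ R
              column≢row p refl = case subsingleton-finite (_∈ column l) (λ z w z∈ w∈ →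
                  column-row (column-is-column l) p z∈ z∈ w∈ w∈) of λ
                (t , ft , h) → infinite (finite-⊆ ft h)

          finite : ∀ n j k → n ∈ ω → j ∈ ω → k ∈ ω →
            ∃[ t ] (IsFinite t × (∀ x → x ∈ ω₁ → ⟦ piece ⟧ (n ∷ j ∷ k ∷ x ∷ []) → x ∈ t))
          finite n j k _ _ _ = case em {∃[ η ] ⟨ η , j ⟩ ∈ e} of λ where
            (no ¬∃) → ∅ , finite-∅ , λ x _ (y , η , h , _) → ⊥-elim (¬∃ (η , h))
            (yes (η , h)) → case deleted-finite {η} {k} (argument e-function h) of λ (s , fs , p) →
              case finite-⋃ (letᶠ (con n) (same-column [ 1F ∷ 2F ∷ 0F ∷ [] ])) fs
                (λ y _ → subsingleton-finite _ λ x x′ (x∈ , l , r , o) (x′∈ , l′ , r′ , o′) →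
                  case root-unique r r′ of λ { refl → offset-injective x∈ x′∈ o o′ }) of λ
              (t , ft , q) → t , ft , λ x _ (y , η′ , h′ , d , c) →
                q y (p y (subst (λ θ → ⟦ deleted ⟧ (y ∷ θ ∷ k ∷ [])) (e-inj _ _ _ h′ h) d)) x c

          cover : ∀ x → x ∈ ω₁ → ∃[ n ] ∃[ j ] ∃[ k ]
            (n ∈ ω × j ∈ ω × k ∈ ω × ⟦ piece ⟧ (n ∷ j ∷ k ∷ x ∷ []))
          cover x x∈ =
            case root-exists x∈ of λ (l , r) →
            case offset-exists r of λ (n , o) →
            case not-deleted (root-root r) of λ (y , y∈C , survives) →
            case to (∈column (column-is-column l)) y∈C of λ (y∈ , ry) →
            case stage-exists y∈ of λ (η , s) →
            case offset-exists ry of λ (k , oy) →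
            case value e-function (proj₁ (proj₁ (proj₂ s))) of λ (j , hj) →
            case from (∈row (row-is-row η k)) (y∈ , s , l , oy) of λ y∈R →
              n , j , k , proj₁ (proj₂ o) , e∈ _ _ hj , proj₁ (proj₂ oy) ,
              y , η , hj , deleted-intro y∈R (survives _ η k (row-is-row η k) y∈R) , (x∈ , l , ry , o)

    cofinality : M→ED ω₁ ω 𝟐 → IsCofinality ω₁ ω₁
    cofinality ed = proj₁ isω₁
      -- The identity is cofinal.
      , (_ , graph-map (v0 ≡ᶠ v1) (λ x x∈ → x , x∈ , refl) (λ { _ _ _ _ _ _ refl refl → refl })
           , λ x x∈ → x , x , from (∈graph (v0 ≡ᶠ v1)) (x∈ , x∈ , refl) , inj₂ refl)
      , λ γ γ∈ (g , c) → let open Grid γ∈ c in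
          not-essentially-disjoint (ed 𝒜 𝒜-members 𝒜-almost-disjoint)

theorem1p10 : ∀ {ℓ} → ExcludedMiddle ℓ → (𝓜 : ZFModel ℓ) →
    let open SetTheory 𝓜 in
    ∀ ω ω₁ → IsOmega ω → IsOmega₁ ω ω₁ →
    (UD ω ω₁ → ∀ n → n ∈ ω → M→ED ω₁ ω n) ×
    (M→ED ω₁ ω 𝟐 → IsCofinality ω₁ ω₁)
theorem1p10 em 𝓜 ω ω₁ isω isω₁ =
    (λ ud n n∈ 𝒜 members almost-disjoint →
      UniformlyDenumerated.Family.essentially-disjoint isω isω₁ ud n∈ members almost-disjoint)
  , Cofinality.cofinality isω isω₁
  where open ZermeloFraenkel em 𝓜
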